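{- Let $N\ge0$ be an integer, $p,q\ge0$ integers, and $a,b,a_1,\ldots,a_p,b_1,\ldots,b_q,z$ complex numbers with $z\ne0$ such that all denominators below are nonzero. Then \[ {}_{p+1}F_{q+1}^{[N]}\left(\begin{matrix}a,a_1,\ldots,a_p\\ b,b_1,\ldots,b_q\end{matrix};z\right) =\frac{(a)_{N} (b-a)_{N}}{(b)_{N}\, N!} \sum_{n=0}^{N}\frac{(1+n)_{N-n}}{(a+n)_{N-n}}\,\frac{(1+N-n)_{n}}{(b-a+N-n)_{n}}\, {}_{p}F_{q}^{[n]}\left(\begin{matrix}a_1,\ldots,a_p\\ b_1,\ldots,b_q\end{matrix};\frac{n}{N}z\right). \] (For $n=0$ the term ${}_{p}F_{q}^{[0]}$ equals $1$.)
   Context: $(x)_m=x(x+1)\cdots(x+m-1)$ is the rising factorial, $(x)_0=1$. The truncated generalized hypergeometric function is \[ {}_{p}F_{q}^{[N]}\left(\begin{matrix}a_1,\ldots,a_p\\ b_1,\ldots,b_q\end{matrix};z\right)=\sum_{m=0}^{N}\frac{(a_1)_m\cdots(a_p)_m}{(b_1)_m\cdots(b_q)_m\, m!}\,\frac{(N+1-m)_m}{(Nz^{ -1}-m)_m}. \] -}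

module Defs where

open import Algebra.Apartness.Bundles using (HeytingCommutativeRing; HeytingField)
open import Algebra.Bundles using (CommutativeRing)
open import Data.Empty using (⊥; ⊥-elim)
open import Data.Fin.Base using (Fin; zero; suc; toℕ)
open import Data.Fin.Properties using (nonZeroIndex)
open import Data.Nat.Base as ℕ using (ℕ; zero; suc; _!)
import Data.Nat.Properties as ℕ
open import Data.Product.Base using (∃-syntax; _×_; _,_; proj₁; proj₂; uncurry)
open import Data.Sum.Base as Sum using (_⊎_; inj₁; inj₂)
open import Data.Vec.Functional using (Vector)
open import Function.Base using (_∘_)
open import Level using (0ℓ; _⊔_)
open import Relation.Binary.PropositionalEquality using (_≡_; refl; sym; trans; cong; cong₂; subst; module ≡-Reasoning)
open import Relation.Binary.Structures using (IsEquivalence)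
open import Relation.Nullary using (¬_; Dec; yes; no; contradiction)

module _ {c ℓ₁ ℓ₂} (K : HeytingField c ℓ₁ ℓ₂) where

  open HeytingField K
  open CommutativeRing (HeytingCommutativeRing.commutativeRing heytingCommutativeRing) using (semiring)
  open import Algebra.Properties.Semiring.Mult semiring using () renaming (_×_ to _·_)

  embed : ℕ → Carrier
  embed n = n · 1#

  CharacteristicZero : Set ℓ₂
  CharacteristicZero = ∀ n → embed (suc n) # 0#

  SumOfSquares#0 : Set (c ⊔ ℓ₂)
  SumOfSquares#0 = ∀ x y → x # 0# → x * x + y * y # 0#

module Real where

  open import Data.Rational
  open import Data.Rational.Properties
  open import Data.Rational.Solver
  open +-*-Solver using (solve; _:=_; _:+_; _:*_; _:-_; :-_)

  private variable
    I : Set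
    h : I → ℕ
    d e f : I → ℚ
    ε p q r : ℚ

  Eventually : (I → ℕ) → (I → Set) → Set
  Eventually h P = ∃[ k ] (∀ i → k ℕ.≤ h i → P i)

  -- d i tends to 0 as h i tends to infinity.
  Vanishes : (I → ℕ) → (I → ℚ) → Set
  Vanishes h d = ∀ ε → 0ℚ < ε → Eventually h (λ i → ∣ d i ∣ < ε)

  -- k ≤ m ⊓ n says that both k ≤ m and k ≤ n.
  Cauchy : (ℕ → ℚ) → Set
  Cauchy x = Vanishes (uncurry ℕ._⊓_) (λ (m , n) → x m - x n)

  record ℝ : Set where
    constructor mkℝ
    field
      seq    : ℕ → ℚ
      cauchy : Cauchy seq

  open ℝ public

  infix 4 _≈_ _#_

  _≈_ : ℝ → ℝ → Set
  x ≈ y = Vanishes (λ n → n) (λ n → seq x n - seq y n)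

  _#_ : ℝ → ℝ → Set
  x # y = ∃[ ε ] 0ℚ < ε × Eventually (λ n → n) (λ n → ε ≤ ∣ seq x n - seq y n ∣)

  private

    ev-map : {P Q : I → Set} → (∀ i → P i → Q i) → Eventually h P → Eventually h Q
    ev-map g (k , P) = k , λ i k≤i → g i (P i k≤i)

    ev-zip : {P Q R : I → Set} → (∀ i → P i → Q i → R i) →
             Eventually h P → Eventually h Q → Eventually h R
    ev-zip g (j , P) (k , Q) = j ℕ.⊔ k , λ i jk≤i →
      g i (P i (ℕ.≤-trans (ℕ.m≤m⊔n j k) jk≤i)) (Q i (ℕ.≤-trans (ℕ.m≤n⊔m j k) jk≤i))

    ev-pair : {P : ℕ → Set} → Eventually (λ n → n) P → Eventually (uncurry ℕ._⊓_) (λ (m , n) → P m × P n)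
    ev-pair (k , P) = k , λ (m , n) k≤ →
      P m (ℕ.≤-trans k≤ (ℕ.m⊓n≤m m n)) , P n (ℕ.≤-trans k≤ (ℕ.m⊓n≤n m n))

    ev-⊥ : ¬ Eventually (λ (n : ℕ) → n) (λ _ → ⊥)
    ev-⊥ (k , P) = P k ℕ.≤-refl

    half>0 : 0ℚ < p → 0ℚ < p * ½
    half>0 {p} 0<p = positive⁻¹ (p * ½) {{pos*pos⇒pos p {{positive 0<p}} ½}}

    *>0 : 0ℚ < p → 0ℚ < q → 0ℚ < p * q
    *>0 {p} {q} 0<p 0<q = positive⁻¹ (p * q) {{pos*pos⇒pos p {{positive 0<p}} q {{positive 0<q}}}}

    halves : ∀ p → p * ½ + p * ½ ≡ p
    halves p = trans (sym (*-distribˡ-+ p ½ ½)) (*-identityʳ p)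

    p-q≡-[q-p] : ∀ p q → p - q ≡ - (q - p)
    p-q≡-[q-p] = solve 2 (λ p q → p :- q := :- (q :- p)) refl

    p-r≡ : ∀ p q r → p - r ≡ (p - q) + (q - r)
    p-r≡ = solve 3 (λ p q r → p :- r := (p :- q) :+ (q :- r)) refl

    +-diff : ∀ p q r s → (p + q) - (r + s) ≡ (p - r) + (q - s)
    +-diff = solve 4 (λ p q r s → (p :+ q) :- (r :+ s) := (p :- r) :+ (q :- s)) refl

    *-diff : ∀ p q r s → p * q - r * s ≡ p * (q - s) + s * (p - r)
    *-diff = solve 4 (λ p q r s → p :* q :- r :* s := p :* (q :- s) :+ s :* (p :- r)) refl

    neg-diff : ∀ p q → - p - - q ≡ - (p - q)
    neg-diff = solve 2 (λ p q → :- p :- :- q := :- (p :- q)) refl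

    cross-diff : ∀ p q r s → r * (q * s) - s * (p * r) ≡ - (r * s) * (p - q)
    cross-diff = solve 4 (λ p q r s → r :* (q :* s) :- s :* (p :* r) := :- (r :* s) :* (p :- q)) refl

    ∣p-q∣≡∣q-p∣ : ∀ p q → ∣ p - q ∣ ≡ ∣ q - p ∣
    ∣p-q∣≡∣q-p∣ p q = trans (cong ∣_∣ (p-q≡-[q-p] p q)) (∣-p∣≡∣p∣ (q - p))

    p≡[p-q]+q : ∀ p q → p ≡ (p - q) + q
    p≡[p-q]+q = solve 2 (λ p q → p := (p :- q) :+ q) refl

    p-0≡p : ∀ p → p - 0ℚ ≡ p
    p-0≡p = +-identityʳ

    ∣p∣≤∣p-q∣+∣q∣ : ∀ p q → ∣ p ∣ ≤ ∣ p - q ∣ + ∣ q ∣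
    ∣p∣≤∣p-q∣+∣q∣ p q = subst (λ r → ∣ r ∣ ≤ ∣ p - q ∣ + ∣ q ∣) (sym (p≡[p-q]+q p q)) (∣p+q∣≤∣p∣+∣q∣ (p - q) q)

    ∣p-r∣≤ : ∀ p q r → ∣ p - r ∣ ≤ ∣ p - q ∣ + ∣ q - r ∣
    ∣p-r∣≤ p q r = subst (λ s → ∣ s ∣ ≤ ∣ p - q ∣ + ∣ q - r ∣)
      (sym (p-r≡ p q r))
      (∣p+q∣≤∣p∣+∣q∣ (p - q) (q - r))

    *-mono-≤′ : ∀ {p q r s} → 0ℚ ≤ p → p ≤ q → 0ℚ ≤ r → r ≤ s → p * r ≤ q * s
    *-mono-≤′ {p} {q} {r} {s} 0≤p p≤q 0≤r r≤s = ≤-trans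
      (*-monoʳ-≤-nonNeg r {{nonNegative 0≤r}} p≤q)
      (*-monoˡ-≤-nonNeg q {{nonNegative (≤-trans 0≤p p≤q)}} r≤s)

    1/′ : ∀ p → 0ℚ < p → ℚ
    1/′ p 0<p = 1/_ p {{>-nonZero 0<p}}

    1/′>0 : ∀ p (0<p : 0ℚ < p) → 0ℚ < 1/′ p 0<p
    1/′>0 p 0<p = positive⁻¹ (1/′ p 0<p) {{1/pos⇒pos p {{positive 0<p}}}}

    p*1/′p : ∀ p (0<p : 0ℚ < p) → p * 1/′ p 0<p ≡ 1ℚ
    p*1/′p p 0<p = *-inverseʳ p {{>-nonZero 0<p}}

    v-dom : 0ℚ < p → Eventually h (λ i → ∣ e i ∣ ≤ p * ∣ d i ∣) → Vanishes h d → Vanishes h e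
    v-dom {p} {e = e} {d = d} 0<p dom v ε 0<ε = ev-zip bound dom (v (1/′ p 0<p * ε) (*>0 (1/′>0 p 0<p) 0<ε))
      where
      bound : ∀ i → ∣ e i ∣ ≤ p * ∣ d i ∣ → ∣ d i ∣ < 1/′ p 0<p * ε → ∣ e i ∣ < ε
      bound i e≤pd d<ε/p = ≤-<-trans e≤pd (subst (p * ∣ d i ∣ <_)
        (trans (sym (*-assoc p _ ε)) (trans (cong (_* ε) (p*1/′p p 0<p)) (*-identityˡ ε)))
        (*-monoʳ-<-pos p {{positive 0<p}} d<ε/p))

    v-≤ : (∀ i → ∣ e i ∣ ≤ ∣ d i ∣) → Vanishes h d → Vanishes h e
    v-≤ e≤d v ε 0<ε = ev-map (λ i → ≤-<-trans (e≤d i)) (v ε 0<ε)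

    v-≡ : (∀ i → e i ≡ d i) → Vanishes h d → Vanishes h e
    v-≡ e≡d = v-≤ (λ i → ≤-reflexive (cong ∣_∣ (e≡d i)))

    v-0 : (∀ i → d i ≡ 0ℚ) → Vanishes h d
    v-0 d≡0 ε 0<ε = 0 , λ i _ → subst (λ p → ∣ p ∣ < ε) (sym (d≡0 i)) 0<ε

    v-+ : Vanishes h d → Vanishes h e → Vanishes h (λ i → d i + e i)
    v-+ {d = d} {e = e} v w ε 0<ε =
      ev-zip (λ i d< e< → ≤-<-trans (∣p+q∣≤∣p∣+∣q∣ (d i) (e i)) (subst (∣ d i ∣ + ∣ e i ∣ <_) (halves ε) (+-mono-< d< e<)))
        (v (ε * ½) (half>0 0<ε)) (w (ε * ½) (half>0 0<ε))

    v-neg : Vanishes h d → Vanishes h (λ i → - d i)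
    v-neg {d = d} = v-≤ (λ i → ≤-reflexive (∣-p∣≡∣p∣ (d i)))

    v-* : 0ℚ < p → Eventually h (λ i → ∣ f i ∣ ≤ p) → Vanishes h d → Vanishes h (λ i → f i * d i)
    v-* {p = p} {f = f} {d = d} 0<p f≤p = v-dom 0<p (ev-map
      (λ i fi≤p → ≤-trans (≤-reflexive (∣p*q∣≡∣p∣*∣q∣ (f i) (d i))) (*-monoʳ-≤-nonNeg ∣ d i ∣ {{∣-∣-nonNeg (d i)}} fi≤p)) f≤p)

    Bounded : (I → ℕ) → (I → ℚ) → Set
    Bounded h f = ∃[ p ] 0ℚ < p × Eventually h (λ i → ∣ f i ∣ ≤ p)

    v-*diff : (a b c d : I → ℚ) → Bounded h a → Bounded h d →
              Vanishes h (λ i → a i - c i) → Vanishes h (λ i → b i - d i) →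
              Vanishes h (λ i → a i * b i - c i * d i)
    v-*diff {h = h} a b c d (p , 0<p , a≤p) (q , 0<q , d≤q) a-c b-d =
      v-≡ {e = λ i → a i * b i - c i * d i} {d = λ i → a i * (b i - d i) + d i * (a i - c i)}
        (λ i → *-diff (a i) (b i) (c i) (d i))
        (v-+ {d = λ i → a i * (b i - d i)} {e = λ i → d i * (a i - c i)}
          (v-* {f = a} {d = λ i → b i - d i} 0<p a≤p b-d)
          (v-* {f = d} {d = λ i → a i - c i} 0<q d≤q a-c))

    bounded : ∀ x → Bounded (λ n → n) (seq x)
    bounded x with k , close ← cauchy x 1ℚ (positive⁻¹ 1ℚ) =
        1ℚ + ∣ seq x k ∣
      , +-mono-<-≤ (positive⁻¹ 1ℚ) (0≤∣p∣ (seq x k))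
      , k , λ n k≤n → ≤-trans (∣p∣≤∣p-q∣+∣q∣ (seq x n) (seq x k))
              (+-monoˡ-≤ ∣ seq x k ∣ (<⇒≤ (close (n , k) (ℕ.⊓-glb k≤n ℕ.≤-refl))))

    ≗⇒≈ : ∀ x y → (∀ n → seq x n ≡ seq y n) → x ≈ y
    ≗⇒≈ x y x≗y = v-0 (λ n → trans (cong (_- seq y n) (x≗y n)) (+-inverseʳ (seq y n)))

  constℝ : ℚ → ℝ
  constℝ p = mkℝ (λ _ → p) (v-0 (λ _ → +-inverseʳ p))

  infix  8 -ℝ_
  infixl 7 _*ℝ_
  infixl 6 _+ℝ_

  _+ℝ_ : ℝ → ℝ → ℝ
  seq    (x +ℝ y) n = seq x n + seq y n
  cauchy (x +ℝ y) = v-≡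
    (λ (m , n) → +-diff (seq x m) (seq y m) (seq x n) (seq y n))
    (v-+ (cauchy x) (cauchy y))

  -ℝ_ : ℝ → ℝ
  seq    (-ℝ x) n = - seq x n
  cauchy (-ℝ x) = v-≡
    (λ (m , n) → neg-diff (seq x m) (seq x n))
    (v-neg (cauchy x))

  _*ℝ_ : ℝ → ℝ → ℝ
  seq    (x *ℝ y) n = seq x n * seq y n
  cauchy (x *ℝ y) = v-*diff (seq x ∘ proj₁) (seq y ∘ proj₁) (seq x ∘ proj₂) (seq y ∘ proj₂)
    (fst (bounded x)) (snd (bounded y)) (cauchy x) (cauchy y)
    where
    fst : Bounded (λ n → n) (seq x) → Bounded (uncurry ℕ._⊓_) (seq x ∘ proj₁)
    fst (p , 0<p , x≤p) = p , 0<p , ev-map (λ _ → proj₁) (ev-pair x≤p)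
    snd : Bounded (λ n → n) (seq y) → Bounded (uncurry ℕ._⊓_) (seq y ∘ proj₂)
    snd (p , 0<p , y≤p) = p , 0<p , ev-map (λ _ → proj₂) (ev-pair y≤p)

  0ℝ 1ℝ : ℝ
  0ℝ = constℝ 0ℚ
  1ℝ = constℝ 1ℚ

  private

    ≈-isEquivalence : IsEquivalence _≈_
    ≈-isEquivalence = record
      { refl  = λ {x} → ≗⇒≈ x x (λ _ → refl)
      ; sym   = λ {x} {y} → v-≤ (λ n → ≤-reflexive (∣p-q∣≡∣q-p∣ (seq y n) (seq x n)))
      ; trans = λ {x} {y} {z} x≈y y≈z → v-≡
          (λ n → p-r≡ (seq x n) (seq y n) (seq z n))
          (v-+ x≈y y≈z)
      }

    +-congℝ : ∀ {x y u v} → x ≈ y → u ≈ v → x +ℝ u ≈ y +ℝ v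
    +-congℝ {x} {y} {u} {v} x≈y u≈v = v-≡
      (λ n → +-diff (seq x n) (seq u n) (seq y n) (seq v n))
      (v-+ x≈y u≈v)

    *-congℝ : ∀ {x y u v} → x ≈ y → u ≈ v → x *ℝ u ≈ y *ℝ v
    *-congℝ {x} {y} {u} {v} = v-*diff (seq x) (seq u) (seq y) (seq v) (bounded x) (bounded v)

    -‿congℝ : ∀ {x y} → x ≈ y → -ℝ x ≈ -ℝ y
    -‿congℝ {x} {y} x≈y = v-≡
      (λ n → neg-diff (seq x n) (seq y n))
      (v-neg x≈y)

  ℝ-commutativeRing : CommutativeRing 0ℓ 0ℓ
  ℝ-commutativeRing = record
    { Carrier = ℝ
    ; _≈_ = _≈_
    ; _+_ = _+ℝ_
    ; _*_ = _*ℝ_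
    ; -_  = -ℝ_
    ; 0#  = 0ℝ
    ; 1#  = 1ℝ
    ; isCommutativeRing = record
      { isRing = record
        { +-isAbelianGroup = record
          { isGroup = record
            { isMonoid = record
              { isSemigroup = record
                { isMagma = record { isEquivalence = ≈-isEquivalence ; ∙-cong = λ {x} {y} {u} {v} → +-congℝ {x} {y} {u} {v} }
                ; assoc = λ x y z → ≗⇒≈ ((x +ℝ y) +ℝ z) (x +ℝ (y +ℝ z)) (λ n → +-assoc (seq x n) (seq y n) (seq z n))
                }
              ; identity = (λ x → ≗⇒≈ (0ℝ +ℝ x) x (λ n → +-identityˡ (seq x n)))
                         , (λ x → ≗⇒≈ (x +ℝ 0ℝ) x (λ n → +-identityʳ (seq x n)))
              }
            ; inverse = (λ x → ≗⇒≈ (-ℝ x +ℝ x) 0ℝ (λ n → +-inverseˡ (seq x n)))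
                      , (λ x → ≗⇒≈ (x +ℝ -ℝ x) 0ℝ (λ n → +-inverseʳ (seq x n)))
            ; ⁻¹-cong = λ {x} {y} → -‿congℝ {x} {y}
            }
          ; comm = λ x y → ≗⇒≈ (x +ℝ y) (y +ℝ x) (λ n → +-comm (seq x n) (seq y n))
          }
        ; *-cong = λ {x} {y} {u} {v} → *-congℝ {x} {y} {u} {v}
        ; *-assoc = λ x y z → ≗⇒≈ ((x *ℝ y) *ℝ z) (x *ℝ (y *ℝ z)) (λ n → *-assoc (seq x n) (seq y n) (seq z n))
        ; *-identity = (λ x → ≗⇒≈ (1ℝ *ℝ x) x (λ n → *-identityˡ (seq x n)))
                     , (λ x → ≗⇒≈ (x *ℝ 1ℝ) x (λ n → *-identityʳ (seq x n)))
        ; distrib = (λ x y z → ≗⇒≈ (x *ℝ (y +ℝ z)) (x *ℝ y +ℝ x *ℝ z) (λ n → *-distribˡ-+ (seq x n) (seq y n) (seq z n)))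
                  , (λ x y z → ≗⇒≈ ((y +ℝ z) *ℝ x) (y *ℝ x +ℝ z *ℝ x) (λ n → *-distribʳ-+ (seq x n) (seq y n) (seq z n)))
        }
      ; *-comm = λ x y → ≗⇒≈ (x *ℝ y) (y *ℝ x) (λ n → *-comm (seq x n) (seq y n))
      }
    }

  private

    half< : 0ℚ < p → p * ½ < p
    half< {p} 0<p = begin-strict
      p * ½         ≡⟨ +-identityʳ (p * ½) ⟨
      p * ½ + 0ℚ    <⟨ +-monoʳ-< (p * ½) (half>0 0<p) ⟩
      p * ½ + p * ½ ≡⟨ halves p ⟩
      p             ∎
      where open ≤-Reasoning

    stays-large : ∀ p q {η} → η ≤ ∣ p ∣ → ∣ p - q ∣ < η * ½ → η * ½ ≤ ∣ q ∣
    stays-large p q {η} η≤p close = ≮⇒≥ λ small → <-irrefl refl (begin-strict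
      η                 ≤⟨ η≤p ⟩
      ∣ p ∣             ≤⟨ ∣p∣≤∣p-q∣+∣q∣ p q ⟩
      ∣ p - q ∣ + ∣ q ∣ <⟨ +-mono-< close small ⟩
      η * ½ + η * ½     ≡⟨ halves η ⟩
      η                 ∎)
      where open ≤-Reasoning

    stays-small : ∀ p q → 0ℚ < ε → ¬ ε * ½ ≤ ∣ p ∣ → ∣ q - p ∣ < ε * ½ * ½ → ∣ q ∣ < ε
    stays-small {ε} p q 0<ε small close = begin-strict
      ∣ q ∣             ≤⟨ ∣p∣≤∣p-q∣+∣q∣ q p ⟩
      ∣ q - p ∣ + ∣ p ∣ <⟨ +-mono-< (<-trans close (half< (half>0 0<ε))) (≰⇒> small) ⟩
      ε * ½ + ε * ½     ≡⟨ halves ε ⟩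
      ε                 ∎
      where open ≤-Reasoning

    locate : ∀ x y → 0ℚ < ε → x # y ⊎ Eventually (λ n → n) (λ n → ∣ seq x n - seq y n ∣ < ε)
    locate {ε} x y 0<ε = split (cauchy (x +ℝ -ℝ y) (ε * ½ * ½) 0<ε/4)
      where
      0<ε/4 : 0ℚ < ε * ½ * ½
      0<ε/4 = half>0 (half>0 0<ε)
      δ : ℕ → ℚ
      δ n = seq x n - seq y n
      split : Eventually (uncurry ℕ._⊓_) (λ (m , n) → ∣ δ m - δ n ∣ < ε * ½ * ½) →
              x # y ⊎ Eventually (λ n → n) (λ n → ∣ seq x n - seq y n ∣ < ε)
      split (k , close) = decide (ε * ½ ≤? ∣ δ k ∣)
        where
        decide : Dec (ε * ½ ≤ ∣ δ k ∣) → x # y ⊎ Eventually (λ n → n) (λ n → ∣ seq x n - seq y n ∣ < ε)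
        decide (yes large) = inj₁ (ε * ½ * ½ , 0<ε/4 , k , λ n k≤n →
          stays-large (δ k) (δ n) large (close (k , n) (ℕ.⊓-glb ℕ.≤-refl k≤n)))
        decide (no small) = inj₂ (k , λ n k≤n →
          stays-small (δ k) (δ n) 0<ε small (close (n , k) (ℕ.⊓-glb k≤n ℕ.≤-refl)))

    #-irrefl : ∀ {x y} → x ≈ y → ¬ x # y
    #-irrefl x≈y (ε , 0<ε , far) = ev-⊥ (ev-zip (λ _ ε≤ <ε → <-irrefl refl (≤-<-trans ε≤ <ε)) far (x≈y ε 0<ε))

    #-sym : ∀ {x y} → x # y → y # x
    #-sym {x} {y} (ε , 0<ε , far) = ε , 0<ε , ev-map (λ n → subst (ε ≤_) (∣p-q∣≡∣q-p∣ (seq x n) (seq y n))) far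

    tri-< : ∀ p q r → ∣ p - q ∣ < ε * ½ → ∣ q - r ∣ < ε * ½ → ¬ ε ≤ ∣ p - r ∣
    tri-< {ε} p q r pq qr ε≤pr = <-irrefl refl (begin-strict
      ε                     ≤⟨ ε≤pr ⟩
      ∣ p - r ∣             ≤⟨ ∣p-r∣≤ p q r ⟩
      ∣ p - q ∣ + ∣ q - r ∣ <⟨ +-mono-< pq qr ⟩
      ε * ½ + ε * ½         ≡⟨ halves ε ⟩
      ε                     ∎)
      where open ≤-Reasoning

    #-cotrans : ∀ {x y} → x # y → ∀ z → x # z ⊎ z # y
    #-cotrans {x} {y} (ε , 0<ε , far) z = cases (locate x z (half>0 0<ε)) (locate z y (half>0 0<ε))
      where
      Close : ℝ → ℝ → Set
      Close u v = Eventually (λ n → n) (λ n → ∣ seq u n - seq v n ∣ < ε * ½)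
      ¬both : Close x z → Close z y → ⊥
      ¬both (i , xz) (j , zy) = ev-⊥ (i ℕ.⊔ j ℕ.⊔ proj₁ far , λ n ≤n → tri-< (seq x n) (seq z n) (seq y n)
        (xz n (ℕ.m⊔n≤o⇒m≤o i j (ℕ.m⊔n≤o⇒m≤o (i ℕ.⊔ j) (proj₁ far) ≤n)))
        (zy n (ℕ.m⊔n≤o⇒n≤o i j (ℕ.m⊔n≤o⇒m≤o (i ℕ.⊔ j) (proj₁ far) ≤n)))
        (proj₂ far n (ℕ.m⊔n≤o⇒n≤o (i ℕ.⊔ j) (proj₁ far) ≤n)))
      cases : x # z ⊎ Close x z → z # y ⊎ Close z y → x # z ⊎ z # y
      cases (inj₁ x#z) _          = inj₁ x#z
      cases (inj₂ _)   (inj₁ z#y) = inj₂ z#y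
      cases (inj₂ xz)  (inj₂ zy)  = ⊥-elim (¬both xz zy)

    #-tight : ∀ x y → ¬ x # y → x ≈ y
    #-tight x y ¬x#y ε 0<ε = Sum.[ (λ x#y → contradiction x#y ¬x#y) , (λ small → small) ]′ (locate x y 0<ε)

    inv : ℚ → ℚ
    inv p with p ≟ 0ℚ
    ... | yes _  = 0ℚ
    ... | no p≢0 = 1/_ p {{≢-nonZero p≢0}}

    p*inv : 0ℚ < ε → ε ≤ ∣ p ∣ → p * inv p ≡ 1ℚ
    p*inv {p = p} 0<ε ε≤p with p ≟ 0ℚ
    ... | yes refl = contradiction (<-≤-trans 0<ε ε≤p) (<-irrefl refl)
    ... | no p≢0   = *-inverseʳ p {{≢-nonZero p≢0}}

    ∣inv∣≤ : ∀ {p ε} (0<ε : 0ℚ < ε) → ε ≤ ∣ p ∣ → ∣ inv p ∣ ≤ 1/′ ε 0<ε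
    ∣inv∣≤ {p} {ε} 0<ε ε≤p = *-cancelˡ-≤-pos ε {{positive 0<ε}} (≤-trans
      (*-monoʳ-≤-nonNeg ∣ inv p ∣ {{∣-∣-nonNeg (inv p)}} ε≤p)
      (≤-reflexive (trans (sym (∣p*q∣≡∣p∣*∣q∣ p (inv p))) (trans (cong ∣_∣ (p*inv 0<ε ε≤p)) (sym (p*1/′p ε 0<ε))))))

    inv-diff : ∀ {ε} p q → 0ℚ < ε → ε ≤ ∣ p ∣ → ε ≤ ∣ q ∣ → inv p - inv q ≡ - (inv p * inv q) * (p - q)
    inv-diff p q 0<ε ε≤p ε≤q = begin
      inv p - inv q                             ≡⟨ cong₂ _-_ (*-identityʳ (inv p)) (*-identityʳ (inv q)) ⟨
      inv p * 1ℚ - inv q * 1ℚ                   ≡⟨ cong₂ (λ s t → inv p * s - inv q * t) (p*inv 0<ε ε≤q) (p*inv 0<ε ε≤p) ⟨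
      inv p * (q * inv q) - inv q * (p * inv p) ≡⟨ cross-diff p q (inv p) (inv q) ⟩
      - (inv p * inv q) * (p - q)               ∎
      where open ≡-Reasoning

    recip : ∀ x → 0ℚ < ε → Eventually (λ n → n) (λ n → ε ≤ ∣ seq x n ∣) → ℝ
    seq    (recip x 0<ε far) n = inv (seq x n)
    cauchy (recip {ε} x 0<ε far) = v-dom (*>0 (1/′>0 ε 0<ε) (1/′>0 ε 0<ε))
      (ev-map bound (ev-pair far)) (cauchy x)
      where
      bound : ((m , n) : ℕ × ℕ) → ε ≤ ∣ seq x m ∣ × ε ≤ ∣ seq x n ∣ →
              ∣ inv (seq x m) - inv (seq x n) ∣ ≤ 1/′ ε 0<ε * 1/′ ε 0<ε * ∣ seq x m - seq x n ∣
      bound (m , n) (ε≤m , ε≤n) = begin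
        ∣ inv a - inv b ∣                          ≡⟨ cong ∣_∣ (inv-diff a b 0<ε ε≤m ε≤n) ⟩
        ∣ - (inv a * inv b) * (a - b) ∣            ≡⟨ ∣p*q∣≡∣p∣*∣q∣ (- (inv a * inv b)) (a - b) ⟩
        ∣ - (inv a * inv b) ∣ * ∣ a - b ∣          ≡⟨ cong (_* ∣ a - b ∣) (trans (∣-p∣≡∣p∣ (inv a * inv b)) (∣p*q∣≡∣p∣*∣q∣ (inv a) (inv b))) ⟩
        ∣ inv a ∣ * ∣ inv b ∣ * ∣ a - b ∣          ≤⟨ *-monoʳ-≤-nonNeg ∣ a - b ∣ {{∣-∣-nonNeg (a - b)}}
                                                       (*-mono-≤′ (0≤∣p∣ (inv a)) (∣inv∣≤ 0<ε ε≤m) (0≤∣p∣ (inv b)) (∣inv∣≤ 0<ε ε≤n)) ⟩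
        1/′ ε 0<ε * 1/′ ε 0<ε * ∣ a - b ∣          ∎
        where
        open ≤-Reasoning
        a b : ℚ
        a = seq x m
        b = seq x n

    *-recip : ∀ x (0<ε : 0ℚ < ε) far → x *ℝ recip {ε} x 0<ε far ≈ 1ℝ
    *-recip x 0<ε (k , far) δ 0<δ = k , λ n k≤n →
      subst (λ p → ∣ p - 1ℚ ∣ < δ) (sym (p*inv 0<ε (far n k≤n))) 0<δ

    open CommutativeRing ℝ-commutativeRing using () renaming (trans to ≈-trans; *-comm to *ℝ-comm)

    #⇒invertibleℝ : ∀ {x y} → x # y → ∃[ u ] (u *ℝ (x +ℝ -ℝ y) ≈ 1ℝ × (x +ℝ -ℝ y) *ℝ u ≈ 1ℝ)
    #⇒invertibleℝ {x} {y} (ε , 0<ε , far) =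
      u , ≈-trans {u *ℝ δ} {δ *ℝ u} {1ℝ} (*ℝ-comm u δ) (*-recip δ 0<ε far) , *-recip δ 0<ε far
      where δ u : ℝ
            δ = x +ℝ -ℝ y
            u = recip δ 0<ε far

    far-from-0 : ∀ a b p r → p * r ≡ 1ℚ → ∣ a ∣ ≤ p → ∣ a * b - 1ℚ ∣ < ½ → r * ½ ≤ ∣ b ∣
    far-from-0 a b p r pr≡1 a≤p close = ≮⇒≥ λ small → <-irrefl refl (begin-strict
      1ℚ                               ≤⟨ ∣p∣≤∣p-q∣+∣q∣ 1ℚ (a * b) ⟩
      ∣ 1ℚ - a * b ∣ + ∣ a * b ∣       ≡⟨ cong₂ _+_ (∣p-q∣≡∣q-p∣ 1ℚ (a * b)) (∣p*q∣≡∣p∣*∣q∣ a b) ⟩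
      ∣ a * b - 1ℚ ∣ + ∣ a ∣ * ∣ b ∣   ≤⟨ +-monoʳ-≤ ∣ a * b - 1ℚ ∣ (*-mono-≤′ (0≤∣p∣ a) a≤p (0≤∣p∣ b) (<⇒≤ small)) ⟩
      ∣ a * b - 1ℚ ∣ + p * (r * ½)     ≡⟨ cong (∣ a * b - 1ℚ ∣ +_) (trans (sym (*-assoc p r ½)) (trans (cong (_* ½) pr≡1) (*-identityˡ ½))) ⟩
      ∣ a * b - 1ℚ ∣ + ½               <⟨ +-monoˡ-< ½ close ⟩
      ½ + ½                            ≡⟨⟩
      1ℚ                               ∎)
      where open ≤-Reasoning

    invertible⇒#ℝ : ∀ {x y} → ∃[ u ] (u *ℝ (x +ℝ -ℝ y) ≈ 1ℝ × (x +ℝ -ℝ y) *ℝ u ≈ 1ℝ) → x # y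
    invertible⇒#ℝ {x} {y} (u , uδ≈1 , _) = go (bounded u) (uδ≈1 ½ (positive⁻¹ ½))
      where
      go : Bounded (λ n → n) (seq u) →
           Eventually (λ n → n) (λ n → ∣ seq u n * (seq x n - seq y n) - 1ℚ ∣ < ½) → x # y
      go (p , 0<p , i , u≤p) (j , close) = 1/′ p 0<p * ½ , half>0 (1/′>0 p 0<p) , i ℕ.⊔ j , λ n ≤n →
        far-from-0 (seq u n) (seq x n - seq y n) p (1/′ p 0<p) (p*1/′p p 0<p)
          (u≤p n (ℕ.m⊔n≤o⇒m≤o i j ≤n)) (close n (ℕ.m⊔n≤o⇒n≤o i j ≤n))

  ℝ-heytingField : HeytingField 0ℓ 0ℓ 0ℓ
  ℝ-heytingField = record
    { Carrier = ℝ
    ; _≈_ = _≈_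
    ; _#_ = _#_
    ; _+_ = _+ℝ_
    ; _*_ = _*ℝ_
    ; -_  = -ℝ_
    ; 0#  = 0ℝ
    ; 1#  = 1ℝ
    ; isHeytingField = record
      { isHeytingCommutativeRing = record
        { isCommutativeRing   = CommutativeRing.isCommutativeRing ℝ-commutativeRing
        ; isApartnessRelation = record
          { irrefl  = λ {x} {y} → #-irrefl {x} {y}
          ; sym     = λ {x} {y} → #-sym {x} {y}
          ; cotrans = λ {x} {y} → #-cotrans {x} {y}
          }
        ; #⇒invertible = λ {x} {y} → #⇒invertibleℝ {x} {y}
        ; invertible⇒# = λ {x} {y} → invertible⇒#ℝ {x} {y}
        }
      ; tight = λ x y → #-tight x y , #-irrefl {x} {y}
      }
    }

  private
    0≤n·1 : ∀ n k → 0ℚ ≤ seq (embed ℝ-heytingField n) k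
    0≤n·1 zero    k = ≤-refl
    0≤n·1 (suc n) k = +-mono-≤ (<⇒≤ (positive⁻¹ 1ℚ)) (0≤n·1 n k)

    p*p≡∣p∣*∣p∣ : ∀ p → p * p ≡ ∣ p ∣ * ∣ p ∣
    p*p≡∣p∣*∣p∣ p with ∣p∣≡p∨∣p∣≡-p p
    ... | inj₁ eq = sym (cong₂ _*_ eq eq)
    ... | inj₂ eq = trans (-p*-p p) (sym (cong₂ _*_ eq eq))
      where
      -p*-p : ∀ p → p * p ≡ - p * - p
      -p*-p = solve 1 (λ p → p :* p := :- p :* :- p) refl

    0≤p*p : ∀ p → 0ℚ ≤ p * p
    0≤p*p p = subst (0ℚ ≤_) (sym (p*p≡∣p∣*∣p∣ p))
      (*-mono-≤′ ≤-refl (0≤∣p∣ p) ≤-refl (0≤∣p∣ p))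

    squares : ∀ p q → 0ℚ < ε → ε ≤ ∣ p - 0ℚ ∣ → ε * ε ≤ ∣ p * p + q * q - 0ℚ ∣
    squares {ε} p q 0<ε ε≤p-0 = begin
      ε * ε                 ≤⟨ *-mono-≤′ (<⇒≤ 0<ε) ε≤p (<⇒≤ 0<ε) ε≤p ⟩
      ∣ p ∣ * ∣ p ∣         ≡⟨ p*p≡∣p∣*∣p∣ p ⟨
      p * p                 ≡⟨ +-identityʳ (p * p) ⟨
      p * p + 0ℚ            ≤⟨ +-monoʳ-≤ (p * p) (0≤p*p q) ⟩
      p * p + q * q         ≡⟨ 0≤p⇒∣p∣≡p (+-mono-≤ (0≤p*p p) (0≤p*p q)) ⟨
      ∣ p * p + q * q ∣     ≡⟨ cong ∣_∣ (p-0≡p (p * p + q * q)) ⟨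
      ∣ p * p + q * q - 0ℚ ∣ ∎
      where
      open ≤-Reasoning
      ε≤p : ε ≤ ∣ p ∣
      ε≤p = subst (λ r → ε ≤ ∣ r ∣) (p-0≡p p) ε≤p-0

  ℝ-sumOfSquares#0 : SumOfSquares#0 ℝ-heytingField
  ℝ-sumOfSquares#0 x y (ε , 0<ε , k , far) = ε * ε , *>0 0<ε 0<ε , k , λ n k≤n → squares (seq x n) (seq y n) 0<ε (far n k≤n)

  ℝ-characteristicZero : CharacteristicZero ℝ-heytingField
  ℝ-characteristicZero n = 1ℚ , positive⁻¹ 1ℚ , 0 , λ k _ → 1≤ (seq (embed ℝ-heytingField n) k) (0≤n·1 n k)
    where
    1≤ : ∀ p → 0ℚ ≤ p → 1ℚ ≤ ∣ 1ℚ + p - 0ℚ ∣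
    1≤ p 0≤p = begin
      1ℚ                ≡⟨ +-identityʳ 1ℚ ⟨
      1ℚ + 0ℚ           ≤⟨ +-monoʳ-≤ 1ℚ 0≤p ⟩
      1ℚ + p            ≡⟨ 0≤p⇒∣p∣≡p (+-mono-≤ (<⇒≤ (positive⁻¹ 1ℚ)) 0≤p) ⟨
      ∣ 1ℚ + p ∣        ≡⟨ cong ∣_∣ (p-0≡p (1ℚ + p)) ⟨
      ∣ 1ℚ + p - 0ℚ ∣   ∎
      where open ≤-Reasoning

-- F[i] with i² = -1, which is again a field as soon as x² + y² is non-zero
-- whenever x is.
module Adjoin-i
  {c ℓ₁ ℓ₂} (F : HeytingField c ℓ₁ ℓ₂)
  (squares#0 : SumOfSquares#0 F)
  where

  open HeytingField F renaming (refl to ≈-refl; sym to ≈-sym; trans to ≈-trans)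
  private
    R = HeytingCommutativeRing.commutativeRing heytingCommutativeRing
    module R = CommutativeRing R
  open import Algebra.Properties.Ring R.ring
  open import Algebra.Apartness.Properties.HeytingCommutativeRing heytingCommutativeRing
  open import Algebra.Solver.Ring.NaturalCoefficients.Default R.commutativeSemiring
  open import Relation.Binary.Reasoning.Setoid setoid

  infixl 6 _+i_
  record F[i] : Set c where
    constructor _+i_
    field
      re im : Carrier

  open F[i] public

  infix 4 _≈ᵢ_ _#ᵢ_
  infix  8 -ᵢ_
  infixl 7 _*ᵢ_
  infixl 6 _+ᵢ_

  _≈ᵢ_ : F[i] → F[i] → Set ℓ₁
  z ≈ᵢ w = re z ≈ re w × im z ≈ im w

  _#ᵢ_ : F[i] → F[i] → Set ℓ₂
  z #ᵢ w = re z # re w ⊎ im z # im w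

  _+ᵢ_ _*ᵢ_ : F[i] → F[i] → F[i]
  z +ᵢ w = (re z + re w) +i (im z + im w)
  z *ᵢ w = (re z * re w - im z * im w) +i (re z * im w + im z * re w)

  -ᵢ_ : F[i] → F[i]
  -ᵢ z = (- re z) +i (- im z)

  0ᵢ 1ᵢ : F[i]
  0ᵢ = 0# +i 0#
  1ᵢ = 1# +i 0#

  private

    -≈ : ∀ x y → x - y ≈ x + - 1# * y
    -≈ x y = +-congˡ (≈-sym (-1*x≈-x y))

    sub-cong : ∀ {x y u v} → x ≈ y → u ≈ v → x - u ≈ y - v
    sub-cong x≈y u≈v = +-cong x≈y (-‿cong u≈v)

    *ᵢ-assoc : ∀ x y z → (x *ᵢ y) *ᵢ z ≈ᵢ x *ᵢ (y *ᵢ z)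
    *ᵢ-assoc (a +i b) (p +i q) (r +i s) =
      (begin
        (a * p - b * q) * r - (a * q + b * p) * s             ≈⟨ -≈ _ _ ⟩
        (a * p - b * q) * r + t * ((a * q + b * p) * s)       ≈⟨ +-congʳ (*-congʳ (-≈ _ _)) ⟩
        (a * p + t * (b * q)) * r + t * ((a * q + b * p) * s) ≈⟨ solve 7 (λ a b p q r s t →
             (a :* p :+ t :* (b :* q)) :* r :+ t :* ((a :* q :+ b :* p) :* s)
          := a :* (p :* r :+ t :* (q :* s)) :+ t :* (b :* (p :* s :+ q :* r))) ≈-refl a b p q r s t ⟩
        a * (p * r + t * (q * s)) + t * (b * (p * s + q * r)) ≈⟨ +-congʳ (*-congˡ (-≈ _ _)) ⟨
        a * (p * r - q * s) + t * (b * (p * s + q * r))       ≈⟨ -≈ _ _ ⟨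
        a * (p * r - q * s) - b * (p * s + q * r)             ∎)
      , (begin
        (a * p - b * q) * s + (a * q + b * p) * r             ≈⟨ +-congʳ (*-congʳ (-≈ _ _)) ⟩
        (a * p + t * (b * q)) * s + (a * q + b * p) * r       ≈⟨ solve 7 (λ a b p q r s t →
             (a :* p :+ t :* (b :* q)) :* s :+ (a :* q :+ b :* p) :* r
          := a :* (p :* s :+ q :* r) :+ b :* (p :* r :+ t :* (q :* s))) ≈-refl a b p q r s t ⟩
        a * (p * s + q * r) + b * (p * r + t * (q * s))       ≈⟨ +-congˡ (*-congˡ (-≈ _ _)) ⟨
        a * (p * s + q * r) + b * (p * r - q * s)             ∎)
      where t = - 1#

    *ᵢ-comm : ∀ x y → x *ᵢ y ≈ᵢ y *ᵢ x
    *ᵢ-comm (a +i b) (p +i q) =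
      sub-cong (*-comm a p) (*-comm b q) , ≈-trans (+-comm _ _) (+-cong (*-comm b p) (*-comm a q))

    *ᵢ-distribˡ : ∀ x y z → x *ᵢ (y +ᵢ z) ≈ᵢ x *ᵢ y +ᵢ x *ᵢ z
    *ᵢ-distribˡ (a +i b) (p +i q) (r +i s) =
      (begin
        a * (p + r) - b * (q + s)                         ≈⟨ -≈ _ _ ⟩
        a * (p + r) + t * (b * (q + s))                   ≈⟨ solve 7 (λ a b p q r s t →
             a :* (p :+ r) :+ t :* (b :* (q :+ s))
          := (a :* p :+ t :* (b :* q)) :+ (a :* r :+ t :* (b :* s))) ≈-refl a b p q r s t ⟩
        (a * p + t * (b * q)) + (a * r + t * (b * s))     ≈⟨ +-cong (-≈ _ _) (-≈ _ _) ⟨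
        (a * p - b * q) + (a * r - b * s)                 ∎)
      , solve 6 (λ a b p q r s →
             a :* (q :+ s) :+ b :* (p :+ r)
          := (a :* q :+ b :* p) :+ (a :* s :+ b :* r)) ≈-refl a b p q r s
      where t = - 1#

    *ᵢ-identityˡ : ∀ x → 1ᵢ *ᵢ x ≈ᵢ x
    *ᵢ-identityˡ (a +i b) =
        ≈-trans (sub-cong (*-identityˡ a) (zeroˡ b)) (x-0≈x a)
      , ≈-trans (+-cong (*-identityˡ b) (zeroˡ a)) (+-identityʳ b)

    *ᵢ-cong : ∀ {x y u v} → x ≈ᵢ y → u ≈ᵢ v → x *ᵢ u ≈ᵢ y *ᵢ v
    *ᵢ-cong (re₁ , im₁) (re₂ , im₂) =
      sub-cong (*-cong re₁ re₂) (*-cong im₁ im₂) , +-cong (*-cong re₁ im₂) (*-cong im₁ re₂)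

    ≈ᵢ-trans : ∀ {x y z} → x ≈ᵢ y → y ≈ᵢ z → x ≈ᵢ z
    ≈ᵢ-trans (p , q) (r , s) = ≈-trans p r , ≈-trans q s

    ≈ᵢ-sym : ∀ {x y} → x ≈ᵢ y → y ≈ᵢ x
    ≈ᵢ-sym (p , q) = ≈-sym p , ≈-sym q

  commutativeRing : CommutativeRing c ℓ₁
  commutativeRing = record
    { Carrier = F[i]
    ; _≈_ = _≈ᵢ_
    ; _+_ = _+ᵢ_
    ; _*_ = _*ᵢ_
    ; -_  = -ᵢ_
    ; 0#  = 0ᵢ
    ; 1#  = 1ᵢ
    ; isCommutativeRing = record
      { isRing = record
        { +-isAbelianGroup = record
          { isGroup = record
            { isMonoid = record
              { isSemigroup = record
                { isMagma = record
                  { isEquivalence = record { refl = ≈-refl , ≈-refl ; sym = ≈ᵢ-sym ; trans = ≈ᵢ-trans }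
                  ; ∙-cong = λ (p , q) (r , s) → +-cong p r , +-cong q s
                  }
                ; assoc = λ x y z → +-assoc _ _ _ , +-assoc _ _ _
                }
              ; identity = (λ x → +-identityˡ _ , +-identityˡ _) , (λ x → +-identityʳ _ , +-identityʳ _)
              }
            ; inverse = (λ x → -‿inverseˡ _ , -‿inverseˡ _) , (λ x → -‿inverseʳ _ , -‿inverseʳ _)
            ; ⁻¹-cong = λ (p , q) → -‿cong p , -‿cong q
            }
          ; comm = λ x y → +-comm _ _ , +-comm _ _
          }
        ; *-cong = *ᵢ-cong
        ; *-assoc = *ᵢ-assoc
        ; *-identity = *ᵢ-identityˡ , λ x → ≈ᵢ-trans (*ᵢ-comm x 1ᵢ) (*ᵢ-identityˡ x)
        ; distrib = *ᵢ-distribˡ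
                  , λ x y z → ≈ᵢ-trans (*ᵢ-comm (y +ᵢ z) x) (≈ᵢ-trans (*ᵢ-distribˡ x y z)
                      (let (p , q) = *ᵢ-comm x y ; (r , s) = *ᵢ-comm x z in +-cong p r , +-cong q s))
        }
      ; *-comm = *ᵢ-comm
      }
    }

  private

    x#y⇒x-y#0 : ∀ {x y} → x # y → x - y # 0#
    x#y⇒x-y#0 {x} {y} x#y with u , u*[x-y]≈1 , _ ← #⇒invertible x#y =
      invertibleˡ⇒# (u , ≈-trans (*-congˡ (x-0≈x (x - y))) u*[x-y]≈1)

    x-y#0⇒x#y : ∀ {x y} → x - y # 0# → x # y
    x-y#0⇒x#y {x} {y} x-y#0 with u , u*[x-y]≈1 , _ ← #⇒invertible x-y#0 =
      invertibleˡ⇒# (u , ≈-trans (*-congˡ (≈-sym (x-0≈x (x - y)))) u*[x-y]≈1)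

    xy#0⇒y#0 : ∀ {x y} → x * y # 0# → y # 0#
    xy#0⇒y#0 {x} {y} xy#0 with u , u*xy≈1 , _ ← #⇒invertible xy#0 =
      invertibleˡ⇒# (u * x , ≈-trans (*-congˡ (x-0≈x y)) (≈-trans (*-assoc u x y)
        (≈-trans (*-congˡ (≈-sym (x-0≈x (x * y)))) u*xy≈1)))

    norm#0 : ∀ {x y} → x # 0# ⊎ y # 0# → x * x + y * y # 0#
    norm#0 {x} {y} (inj₁ x#0) = squares#0 x y x#0
    norm#0 {x} {y} (inj₂ y#0) = #-congʳ (+-comm _ _) (squares#0 y x y#0)

    recip : ∀ z → z #ᵢ 0ᵢ → ∃[ w ] z *ᵢ w ≈ᵢ 1ᵢ
    recip (a +i b) z#0 with u , _ , norm*u≈1 ← #⇒invertible (norm#0 z#0) =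
        (a * u) +i (- (b * u))
      , (begin
          a * (a * u) - b * - (b * u)     ≈⟨ +-congˡ (-‿cong (-‿distribʳ-* b (b * u))) ⟨
          a * (a * u) - - (b * (b * u))   ≈⟨ +-congˡ (-‿involutive _) ⟩
          a * (a * u) + b * (b * u)       ≈⟨ +-cong (*-assoc a a u) (*-assoc b b u) ⟨
          a * a * u + b * b * u           ≈⟨ distribʳ u (a * a) (b * b) ⟨
          (a * a + b * b) * u             ≈⟨ *-congʳ (x-0≈x _) ⟨
          (a * a + b * b - 0#) * u        ≈⟨ norm*u≈1 ⟩
          1#                              ∎)
      , (begin
          a * - (b * u) + b * (a * u)     ≈⟨ +-congʳ (-‿distribʳ-* a (b * u)) ⟨
          - (a * (b * u)) + b * (a * u)   ≈⟨ +-congˡ (solve 3 (λ a b u → b :* (a :* u) := a :* (b :* u)) ≈-refl a b u) ⟩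
          - (a * (b * u)) + a * (b * u)   ≈⟨ -‿inverseˡ _ ⟩
          0#                              ∎)

  heytingField : HeytingField c ℓ₁ ℓ₂
  heytingField = record
    { Carrier = F[i]
    ; _≈_ = _≈ᵢ_
    ; _#_ = _#ᵢ_
    ; _+_ = _+ᵢ_
    ; _*_ = _*ᵢ_
    ; -_  = -ᵢ_
    ; 0#  = 0ᵢ
    ; 1#  = 1ᵢ
    ; isHeytingField = record
      { isHeytingCommutativeRing = record
        { isCommutativeRing   = CommutativeRing.isCommutativeRing commutativeRing
        ; isApartnessRelation = record
          { irrefl  = irreflᵢ
          ; sym     = Sum.map #-sym #-sym
          ; cotrans = λ { (inj₁ x#y) z → Sum.map inj₁ inj₁ (#-cotrans x#y (re z))
                        ; (inj₂ x#y) z → Sum.map inj₂ inj₂ (#-cotrans x#y (im z)) }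
          }
        ; #⇒invertible = λ {x} {y} x#y → let (u , d*u≈1) = recip (x +ᵢ -ᵢ y) (Sum.map x#y⇒x-y#0 x#y⇒x-y#0 x#y)
                                         in u , ≈ᵢ-trans (*ᵢ-comm u (x +ᵢ -ᵢ y)) d*u≈1 , d*u≈1
        ; invertible⇒# = λ (u , u*d≈1 , _) → Sum.map
            (λ p#0 → x-y#0⇒x#y (xy#0⇒y#0 p#0))
            (λ 0#q → x-y#0⇒x#y (xy#0⇒y#0 (#-sym 0#q)))
            (#-cotrans (x-y#0⇒x#y (#-congʳ (≈-sym (proj₁ u*d≈1)) 1#0)) 0#)
        }
      ; tight = λ x y → (λ ¬x#y → proj₁ (tight _ _) (¬x#y ∘ inj₁) , proj₁ (tight _ _) (¬x#y ∘ inj₂)) , irreflᵢ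
      }
    }
    where
    irreflᵢ : ∀ {x y} → x ≈ᵢ y → ¬ x #ᵢ y
    irreflᵢ (p , _) (inj₁ x#y) = #-irrefl p x#y
    irreflᵢ (_ , q) (inj₂ x#y) = #-irrefl q x#y

  private
    re-embed : ∀ n → re (embed heytingField n) ≡ embed F n
    re-embed zero    = refl
    re-embed (suc n) = cong (1# +_) (re-embed n)

  characteristicZero : CharacteristicZero F → CharacteristicZero heytingField
  characteristicZero char0 n = inj₁ (subst (_# 0#) (sym (re-embed (suc n))) (char0 n))

module Hypergeometric {c ℓ₁ ℓ₂} (K : HeytingField c ℓ₁ ℓ₂) (char0 : CharacteristicZero K) where

  open HeytingField K
  open CommutativeRing (HeytingCommutativeRing.commutativeRing heytingCommutativeRing) using (+-monoid; *-monoid)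
  open import Algebra.Properties.Monoid.Sum +-monoid public using (sum; sum-syntax; sum⁺-syntax)
  open import Algebra.Properties.Monoid.Sum *-monoid using () renaming (sum to ∏)

  infixl 7 _/_[_]
  infix  9 _⟨_⟩

  ι : ℕ → Carrier
  ι = embed K

  ι#0 : ∀ n → .{{ℕ.NonZero n}} → ι n # 0#
  ι#0 (suc n) = char0 n

  -- #⇒invertible yields an inverse of y - 0#, which is equal to y.
  _/_[_] : ∀ x y → y # 0# → Carrier
  x / y [ y#0 ] = x * proj₁ (#⇒invertible y#0)

  -- x ⟨ m ⟩ is the rising factorial x (x + 1) ⋯ (x + m - 1).
  _⟨_⟩ : Carrier → ℕ → Carrier
  x ⟨ zero ⟩  = 1#
  x ⟨ suc m ⟩ = x ⟨ m ⟩ * (x + ι m)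

  -- "Non-zero" is apartness from 0#, i.e. invertibility; classically x # 0# is
  -- the same as ¬ x ≈ 0#.
  --
  -- The denominators occurring in the truncated hypergeometric series with
  -- lower parameters bs, up to the index N, are non-zero.
  record Admissible {q} (N : ℕ) (bs : Vector Carrier q) (z : Carrier) : Set ℓ₂ where
    field
      z#0     : z # 0#
      lower#0 : ∀ (m : Fin (suc N)) → ∏ (λ j → bs j ⟨ toℕ m ⟩) * ι (toℕ m !) # 0#
      arg#0   : ∀ (m : Fin (suc N)) → (ι N / z [ z#0 ] - ι (toℕ m)) ⟨ toℕ m ⟩ # 0#

  truncF : ∀ {p q} (N : ℕ) (as : Vector Carrier p) (bs : Vector Carrier q) (z : Carrier) →
           Admissible N bs z → Carrier
  truncF N as bs z adm = ∑[ m ≤ N ]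
    ( ∏ (λ i → as i ⟨ toℕ m ⟩) / (∏ (λ j → bs j ⟨ toℕ m ⟩) * ι (toℕ m !)) [ lower#0 m ]
    * ((ι N + 1# - ι (toℕ m)) ⟨ toℕ m ⟩ / (ι N / z [ z#0 ] - ι (toℕ m)) ⟨ toℕ m ⟩ [ arg#0 m ]) )
    where open Admissible adm

  -- The argument (n / N) z for 1 ≤ n ≤ N, where j : Fin N stands for n = j + 1.
  scaled : (N : ℕ) → Carrier → Fin N → Carrier
  scaled N z j = ι (suc (toℕ j)) / ι N [ ι#0 N {{nonZeroIndex j}} ] * z

  -- The truncated series up to n at (n / N) z, for 0 ≤ n ≤ N. Its argument is
  -- not invertible for n = 0 (and n / N is 0 / 0 if N = 0 as well), where its
  -- value is 1 by convention.
  truncFScaled : ∀ {p q} (N : ℕ) (as : Vector Carrier p) (bs : Vector Carrier q) (z : Carrier) →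
                 (∀ (j : Fin N) → Admissible (suc (toℕ j)) bs (scaled N z j)) →
                 Fin (suc N) → Carrier
  truncFScaled N as bs z adm zero    = 1#
  truncFScaled N as bs z adm (suc j) = truncF (suc (toℕ j)) as bs (scaled N z j) (adm j)

private
  module Complex = Adjoin-i Real.ℝ-heytingField Real.ℝ-sumOfSquares#0

-- Opaque only to keep conversion checking from unfolding complex arithmetic
-- down to sequences of rationals.
opaque

  ℂ-heytingField : HeytingField 0ℓ 0ℓ 0ℓ
  ℂ-heytingField = Complex.heytingField

  ℂ-characteristicZero : CharacteristicZero ℂ-heytingField
  ℂ-characteristicZero = Complex.characteristicZero Real.ℝ-characteristicZero

open HeytingField ℂ-heytingField public using (_≈_; _#_; _+_; _*_; _-_; 0#; 1#) renaming (Carrier to ℂ)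
open Hypergeometric ℂ-heytingField ℂ-characteristicZero public

{-# OPTIONS --safe #-}
module Submission where

-- Put c = b - a and let n ↓ m = (n + 1 - m)_m be the falling factorial, which
-- vanishes for m > n. The right-hand side times (b)_N is
--   Σ_n C(N,n) (a)_n (c)_{N-n} Σ_m T_m (n ↓ m),
-- where T_m does not depend on n because n / ((n/N) z) = N / z. Exchanging the
-- sums leaves the factorial moments
--   Σ_n C(N,n) (a)_n (c)_{N-n} (n ↓ m) = (N ↓ m) (a)_m (b + m)_{N-m},
-- which follow from the Chu–Vandermonde identity. As (b)_N = (b)_m (b + m)_{N-m},
-- the result is the left-hand side times (b)_N.

open import Algebra.Apartness.Bundles using (HeytingCommutativeRing; HeytingField)
open import Algebra.Bundles using (CommutativeRing)
open import Data.Fin.Base as Fin using (Fin; toℕ)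
open import Data.Fin.Properties using (toℕ≤pred[n]; nonZeroIndex)
open import Data.Nat.Base as ℕ using (ℕ; zero; suc; _∸_; _!; z≤n; s≤s)
open import Data.Nat.Combinatorics using (_C_; nC1≡n; nCk+nC[k+1]≡[n+1]C[k+1]; k>n⇒nCk≡0)
import Data.Nat.Properties as ℕ
open import Data.Nat.Tactic.RingSolver using (solve-∀)
open import Data.Product.Base using (_,_; proj₁)
open import Data.Vec.Functional using (Vector; _∷_)
open import Defs using (CharacteristicZero; module Hypergeometric)
open import Function.Base using (_∘_)
open import Relation.Binary.PropositionalEquality as ≡ using (_≡_)

-- Absorption for binomial coefficients.

-- Pascal's rule splits the binomial on the left. One copy of `x` is set aside, the induction
-- hypotheses at `k` and at `suc k` pull out `suc n`, and Pascal's rule one row lower merges the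
-- rest into `suc n` further copies of `x`.
[1+k]*[1+n]C[1+k]≡[1+n]*nCk : ∀ n k → suc k ℕ.* (suc n C suc k) ≡ suc n ℕ.* (n C k)
[1+k]*[1+n]C[1+k]≡[1+n]*nCk zero    zero    = ≡.refl
[1+k]*[1+n]C[1+k]≡[1+n]*nCk zero    (suc k) = ≡.trans
  (≡.cong (suc (suc k) ℕ.*_) (k>n⇒nCk≡0 {1} {suc (suc k)} (s≤s (s≤s z≤n))))
  (≡.trans (ℕ.*-zeroʳ k) (≡.cong (1 ℕ.*_) (≡.sym (k>n⇒nCk≡0 {0} {suc k} (s≤s z≤n)))))
[1+k]*[1+n]C[1+k]≡[1+n]*nCk (suc n) zero    = ≡.trans
  (≡.cong (1 ℕ.*_) (nC1≡n (suc (suc n))))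
  (ℕ.*-comm 1 (suc (suc n)))
[1+k]*[1+n]C[1+k]≡[1+n]*nCk (suc n) (suc k) = begin
  suc (suc k) ℕ.* (suc (suc n) C suc (suc k))            ≡⟨ ≡.cong (suc (suc k) ℕ.*_) (nCk+nC[k+1]≡[n+1]C[k+1] (suc n) (suc k)) ⟨
  suc (suc k) ℕ.* (x ℕ.+ (suc n C suc (suc k)))          ≡⟨ ℕ.*-distribˡ-+ (suc (suc k)) x _ ⟩
  (x ℕ.+ suc k ℕ.* x) ℕ.+ suc (suc k) ℕ.* (suc n C suc (suc k))
    ≡⟨ ≡.cong₂ (λ s t → (x ℕ.+ s) ℕ.+ t) ([1+k]*[1+n]C[1+k]≡[1+n]*nCk n k) ([1+k]*[1+n]C[1+k]≡[1+n]*nCk n (suc k)) ⟩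
  (x ℕ.+ suc n ℕ.* (n C k)) ℕ.+ suc n ℕ.* (n C suc k)    ≡⟨ regroup x (suc n) (n C k) (n C suc k) ⟩
  x ℕ.+ suc n ℕ.* ((n C k) ℕ.+ (n C suc k))              ≡⟨ ≡.cong (λ s → x ℕ.+ suc n ℕ.* s) (nCk+nC[k+1]≡[n+1]C[k+1] n k) ⟩
  suc (suc n) ℕ.* x                                      ∎
  where
  open ≡.≡-Reasoning
  x : ℕ
  x = suc n C suc k
  regroup : ∀ x m c d → (x ℕ.+ m ℕ.* c) ℕ.+ m ℕ.* d ≡ x ℕ.+ m ℕ.* (c ℕ.+ d)
  regroup = solve-∀

-- Natural numbers and division in a Heyting field of characteristic zero.

module _ {c ℓ₁ ℓ₂} (K : HeytingField c ℓ₁ ℓ₂) (char0 : CharacteristicZero K) where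

  open HeytingField K
  open Hypergeometric K char0
  private
    R = HeytingCommutativeRing.commutativeRing heytingCommutativeRing
    module R = CommutativeRing R
  open import Algebra.Apartness.Properties.HeytingCommutativeRing heytingCommutativeRing
    using (x-0≈x; invertibleˡ⇒#; x#0y#0→xy#0; #-congʳ)
  open import Algebra.Properties.AbelianGroup R.+-abelianGroup
    using (⁻¹-∙-comm; xyx⁻¹≈y; //-rightDividesˡ; //-rightDividesʳ)
  open import Algebra.Properties.Monoid.Sum R.*-monoid
    using () renaming (sum to ∏; sum-replicate-zero to ∏-replicate-one)
  open import Algebra.Properties.Semiring.Mult R.semiring using (×-homo-+; ×1-homo-*)
  open import Algebra.Properties.Semiring.Sum R.semiring
    using (sum-cong-≋; sum-replicate-zero; ∑-distrib-+; ∑-comm; *-distribˡ-sum; *-distribʳ-sum)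
  open import Algebra.Solver.Ring.NaturalCoefficients.Default R.commutativeSemiring
    using (solve; _:=_; _:+_; _:*_; con)
  open import Relation.Binary.Reasoning.Setoid setoid

  private variable
    x y u v : Carrier

  ι-+ : ∀ m n → ι (m ℕ.+ n) ≈ ι m + ι n
  ι-+ = ×-homo-+ 1#

  ι-* : ∀ m n → ι (m ℕ.* n) ≈ ι m * ι n
  ι-* = ×1-homo-*

  ι-∸ : ∀ {m n} → m ℕ.≤ n → ι n ≈ ι m + ι (n ∸ m)
  ι-∸ {m} {n} m≤n = trans (reflexive (≡.cong ι (≡.sym (ℕ.m+[n∸m]≡n m≤n)))) (ι-+ m (n ∸ m))

  -- If `w` inverts `x * y`, then `w * x` inverts `y`. This extracts single factors from the
  -- composite denominators of the hypotheses.
  *#0⇒#0 : x * y # 0# → y # 0#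
  *#0⇒#0 {x} {y} xy#0 with w , w*xy≈1 , _ ← #⇒invertible xy#0 = invertibleˡ⇒# (w * x , (begin
    w * x * (y - 0#)   ≈⟨ *-congˡ (x-0≈x y) ⟩
    w * x * y          ≈⟨ *-assoc w x y ⟩
    w * (x * y)        ≈⟨ *-congˡ (x-0≈x (x * y)) ⟨
    w * (x * y - 0#)   ≈⟨ w*xy≈1 ⟩
    1#                 ∎))

  /-cancel : (y#0 : y # 0#) → x / y [ y#0 ] * y ≈ x
  /-cancel {y} {x} y#0 with w , w*y≈1 , _ ← #⇒invertible y#0 = begin
    x * w * y          ≈⟨ *-assoc x w y ⟩
    x * (w * y)        ≈⟨ *-congˡ (*-congˡ (x-0≈x y)) ⟨
    x * (w * (y - 0#)) ≈⟨ *-congˡ w*y≈1 ⟩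
    x * 1#             ≈⟨ *-identityʳ x ⟩
    x                  ∎

  *-cancelʳ-# : y # 0# → u * y ≈ v * y → u ≈ v
  *-cancelʳ-# {y} {u} {v} y#0 uy≈vy = trans (sym (expand u)) (trans (*-congʳ uy≈vy) (expand v))
    where
    expand : ∀ x → x * y * proj₁ (#⇒invertible y#0) ≈ x
    expand x = trans (solve 3 (λ x y w → x :* y :* w := x :* w :* y) refl x y _) (/-cancel y#0)

  /-unique : (y#0 : y # 0#) → u * y ≈ x → u ≈ x / y [ y#0 ]
  /-unique y#0 uy≈x = *-cancelʳ-# y#0 (trans uy≈x (sym (/-cancel y#0)))

  -- A quotient carries a proof that its denominator is apart from zero. Uniqueness of inverses
  -- makes its value independent of that proof, so quotients from different admissibility hypotheses
  -- can be compared.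
  /-cong : {x#0 : x # 0#} {y#0 : y # 0#} → u ≈ v → x ≈ y → u / x [ x#0 ] ≈ v / y [ y#0 ]
  /-cong {x#0 = x#0} {y#0} u≈v x≈y = /-unique y#0 (trans (*-congˡ (sym x≈y)) (trans (/-cancel x#0) u≈v))

  -- Rising factorials.

  ⟨⟩-cong : ∀ m → x ≈ y → x ⟨ m ⟩ ≈ y ⟨ m ⟩
  ⟨⟩-cong zero    x≈y = refl
  ⟨⟩-cong (suc m) x≈y = *-cong (⟨⟩-cong m x≈y) (+-congʳ x≈y)

  ⟨⟩-+ : ∀ x m k → x ⟨ m ℕ.+ k ⟩ ≈ x ⟨ m ⟩ * (x + ι m) ⟨ k ⟩
  ⟨⟩-+ x m zero    = trans (reflexive (≡.cong (x ⟨_⟩) (ℕ.+-identityʳ m))) (sym (*-identityʳ _))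
  ⟨⟩-+ x m (suc k) = begin
    x ⟨ m ℕ.+ suc k ⟩                                    ≡⟨ ≡.cong (x ⟨_⟩) (ℕ.+-suc m k) ⟩
    x ⟨ m ℕ.+ k ⟩ * (x + ι (m ℕ.+ k))                    ≈⟨ *-cong (⟨⟩-+ x m k) (trans (+-congˡ (ι-+ m k)) (sym (+-assoc x _ _))) ⟩
    x ⟨ m ⟩ * (x + ι m) ⟨ k ⟩ * (x + ι m + ι k)          ≈⟨ *-assoc _ _ _ ⟩
    x ⟨ m ⟩ * ((x + ι m) ⟨ k ⟩ * (x + ι m + ι k))        ∎

  ⟨⟩-∸ : ∀ x {m n} → m ℕ.≤ n → x ⟨ n ⟩ ≈ x ⟨ m ⟩ * (x + ι m) ⟨ n ∸ m ⟩
  ⟨⟩-∸ x {m} {n} m≤n = trans (reflexive (≡.cong (x ⟨_⟩) (≡.sym (ℕ.m+[n∸m]≡n m≤n)))) (⟨⟩-+ x m (n ∸ m))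

  ⟨⟩-suc : ∀ x m → x ⟨ suc m ⟩ ≈ x * (x + 1#) ⟨ m ⟩
  ⟨⟩-suc x m = trans (⟨⟩-+ x 1 m) (*-cong
    (trans (*-identityˡ _) (+-identityʳ x))
    (⟨⟩-cong m (+-congˡ (+-identityʳ 1#))))

  ⟨⟩-! : ∀ n k → (1# + ι n) ⟨ k ⟩ * ι (n !) ≈ ι ((n ℕ.+ k) !)
  ⟨⟩-! n zero    = trans (*-identityˡ _) (reflexive (≡.cong (λ k → ι (k !)) (≡.sym (ℕ.+-identityʳ n))))
  ⟨⟩-! n (suc k) = begin
    (1# + ι n) ⟨ k ⟩ * (1# + ι n + ι k) * ι (n !)   ≈⟨ solve 3 (λ x y z → x :* y :* z := y :* (x :* z)) refl _ _ _ ⟩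
    (1# + ι n + ι k) * ((1# + ι n) ⟨ k ⟩ * ι (n !)) ≈⟨ *-cong (sym (ι-+ (suc n) k)) (⟨⟩-! n k) ⟩
    ι (suc (n ℕ.+ k)) * ι ((n ℕ.+ k) !)             ≈⟨ ι-* (suc (n ℕ.+ k)) ((n ℕ.+ k) !) ⟨
    ι (suc (n ℕ.+ k) !)                             ≡⟨ ≡.cong (λ k → ι (k !)) (ℕ.+-suc n k) ⟨
    ι ((n ℕ.+ suc k) !)                             ∎

  -- Falling factorials.

  infix 9 _↓_
  -- The subtraction is that of the field, which makes this definitionally the numerator in
  -- `truncF`.
  _↓_ : ℕ → ℕ → Carrier
  n ↓ m = (ι n + 1# - ι m) ⟨ m ⟩

  -- Both products start at `n + 1 - m`, so the longer one only gains its last factor, `n + 1`.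
  ↓-suc : ∀ n m → suc n ↓ suc m ≈ ι (suc n) * n ↓ m
  ↓-suc n m = begin
    (ι (suc n) + 1# - ι (suc m)) ⟨ m ⟩ * (ι (suc n) + 1# - ι (suc m) + ι m) ≈⟨ *-cong (⟨⟩-cong m shift) (+-congʳ shift) ⟩
    (ι n + 1# - ι m) ⟨ m ⟩ * (ι n + 1# - ι m + ι m)                         ≈⟨ *-congˡ (trans (//-rightDividesˡ (ι m) (ι n + 1#)) (+-comm _ _)) ⟩
    n ↓ m * ι (suc n)                                                      ≈⟨ *-comm _ _ ⟩
    ι (suc n) * n ↓ m                                                      ∎
    where
    shift : ι (suc n) + 1# - ι (suc m) ≈ ι n + 1# - ι m
    shift = begin
      1# + ι n + 1# + - (1# + ι m)         ≈⟨ +-cong (+-assoc _ _ _) (sym (⁻¹-∙-comm 1# (ι m))) ⟩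
      1# + (ι n + 1#) + (- 1# + - ι m)     ≈⟨ +-assoc _ _ _ ⟨
      1# + (ι n + 1#) + - 1# + - ι m       ≈⟨ +-congʳ (xyx⁻¹≈y 1# (ι n + 1#)) ⟩
      ι n + 1# - ι m                       ∎

  -- The last factor of the product is `0 + 1 - (1 + m) + m`, which is zero.
  0↓suc≈0 : ∀ m → 0 ↓ suc m ≈ 0#
  0↓suc≈0 m = trans (*-congˡ (begin
    0# + 1# - (1# + ι m) + ι m       ≈⟨ +-cong (+-cong (+-identityˡ 1#) (sym (⁻¹-∙-comm 1# (ι m)))) refl ⟩
    1# + (- 1# + - ι m) + ι m        ≈⟨ +-congʳ (+-assoc _ _ _) ⟨
    1# + - 1# + - ι m + ι m          ≈⟨ //-rightDividesˡ (ι m) (1# - 1#) ⟩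
    1# - 1#                          ≈⟨ -‿inverseʳ 1# ⟩
    0#                               ∎)) (zeroʳ _)

  n<m⇒n↓m≈0 : ∀ {n m} → n ℕ.< m → n ↓ m ≈ 0#
  n<m⇒n↓m≈0 {zero}  {suc m} _         = 0↓suc≈0 m
  n<m⇒n↓m≈0 {suc n} {suc m} (s≤s n<m) = trans (↓-suc n m) (trans (*-congˡ (n<m⇒n↓m≈0 n<m)) (zeroʳ _))

  absorb : ∀ n k → ι (suc k) * ι (suc n C suc k) ≈ ι (suc n) * ι (n C k)
  absorb n k = trans (sym (ι-* (suc k) (suc n C suc k)))
    (trans (reflexive (≡.cong ι ([1+k]*[1+n]C[1+k]≡[1+n]*nCk n k))) (ι-* (suc n) (n C k)))

  -- In the induction `↓-suc` contributes the factor `n + 1`. Absorption trades it for `k + 1`,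
  -- which completes the factorial.
  ↓≈C*! : ∀ n k → n ↓ k ≈ ι (n C k) * ι (k !)
  ↓≈C*! n       zero    = sym (trans (*-cong (+-identityʳ 1#) (+-identityʳ 1#)) (*-identityˡ 1#))
  ↓≈C*! zero    (suc k) = trans (0↓suc≈0 k) (sym (trans (*-congʳ (reflexive (≡.cong ι (k>n⇒nCk≡0 {0} {suc k} (s≤s z≤n))))) (zeroˡ _)))
  ↓≈C*! (suc n) (suc k) = begin
    suc n ↓ suc k                                ≈⟨ ↓-suc n k ⟩
    ι (suc n) * n ↓ k                            ≈⟨ *-congˡ (↓≈C*! n k) ⟩
    ι (suc n) * (ι (n C k) * ι (k !))            ≈⟨ *-assoc _ _ _ ⟨
    ι (suc n) * ι (n C k) * ι (k !)              ≈⟨ *-congʳ (absorb n k) ⟨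
    ι (suc k) * ι (suc n C suc k) * ι (k !)      ≈⟨ solve 3 (λ x y z → x :* y :* z := y :* (x :* z)) refl _ _ _ ⟩
    ι (suc n C suc k) * (ι (suc k) * ι (k !))    ≈⟨ *-congˡ (ι-* (suc k) (k !)) ⟨
    ι (suc n C suc k) * ι (suc k !)              ∎

  -- Binomial sums: Chu-Vandermonde and factorial moments.

  -- The two sums range over different `Fin` types, so terms are matched by the value of the index.
  sum-pad : ∀ {k l} → k ℕ.≤ l → (f : Vector Carrier k) (g : Vector Carrier l) →
            (∀ i j → toℕ i ≡ toℕ j → f i ≈ g j) → (∀ j → k ℕ.≤ toℕ j → g j ≈ 0#) → sum f ≈ sum g
  sum-pad {l = l} z≤n f g f≈g g≈0 = sym (trans (sum-cong-≋ (λ j → g≈0 j z≤n)) (sum-replicate-zero l))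
  sum-pad (s≤s k≤l) f g f≈g g≈0 = +-cong (f≈g Fin.zero Fin.zero ≡.refl)
    (sum-pad k≤l (f ∘ Fin.suc) (g ∘ Fin.suc) (λ i j i≡j → f≈g _ _ (≡.cong suc i≡j)) (λ j k≤j → g≈0 _ (s≤s k≤j)))

  ∑-pascal : ∀ N (g : ℕ → Carrier) →
             ∑[ n ≤ suc N ] (ι (suc N C toℕ n) * g (toℕ n)) ≈ ∑[ n ≤ N ] (ι (N C toℕ n) * (g (toℕ n) + g (suc (toℕ n))))
  ∑-pascal N g = begin
    ι 1 * g 0 + ∑[ n ≤ N ] (ι (suc N C suc (toℕ n)) * g (suc (toℕ n)))
      ≈⟨ +-congˡ (trans (sum-cong-≋ {suc N} (λ n → pascal (toℕ n))) (∑-distrib-+ same next)) ⟩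
    ι 1 * g 0 + (sum same + sum next)
      ≈⟨ solve 3 (λ x y z → x :+ (y :+ z) := (x :+ z) :+ y) refl (ι 1 * g 0) (sum same) (sum next) ⟩
    -- The isolated term at `0` and `next` form one sum up to `suc N`. Its last term vanishes
    -- because `N C suc N` is zero, which leaves `prev`.
    ∑[ n ≤ suc N ] (ι (N C toℕ n) * g (toℕ n)) + sum same
      ≈⟨ +-congʳ (sum-pad (ℕ.n≤1+n (suc N)) prev _
           (λ i j i≡j → reflexive (≡.cong (λ n → ι (N C n) * g n) i≡j))
           (λ j N<j → trans (*-congʳ (reflexive (≡.cong ι (k>n⇒nCk≡0 N<j)))) (zeroˡ _))) ⟨
    sum prev + sum same
      ≈⟨ ∑-distrib-+ prev same ⟨
    ∑[ n ≤ N ] (prev n + same n)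
      ≈⟨ sum-cong-≋ {suc N} (λ n → sym (distribˡ (ι (N C toℕ n)) (g (toℕ n)) (g (suc (toℕ n))))) ⟩
    ∑[ n ≤ N ] (ι (N C toℕ n) * (g (toℕ n) + g (suc (toℕ n)))) ∎
    where
    prev same next : Vector Carrier (suc N)
    prev n = ι (N C toℕ n) * g (toℕ n)
    same n = ι (N C toℕ n) * g (suc (toℕ n))
    next n = ι (N C suc (toℕ n)) * g (suc (toℕ n))
    pascal : ∀ n → ι (suc N C suc n) * g (suc n) ≈ ι (N C n) * g (suc n) + ι (N C suc n) * g (suc n)
    pascal n = trans (*-congʳ (trans (reflexive (≡.cong ι (≡.sym (nCk+nC[k+1]≡[n+1]C[k+1] N n)))) (ι-+ (N C n) (N C suc n))))
      (distribʳ _ _ _)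

  -- Up to the factor `(a + c)_N`, these are the probabilities of the beta-binomial distribution.
  weight : ∀ N (a c : Carrier) → Vector Carrier (suc N)
  weight N a c n = ι (N C toℕ n) * (a ⟨ toℕ n ⟩ * c ⟨ N ∸ toℕ n ⟩)

  -- By induction on `N`: after Pascal's rule, the two products that share `N C n` exceed the one in
  -- `weight N a c n` by the factors `c + (N - n)` and `a + n`. Their sum `a + c + N` is free of `n`
  -- and leaves the sum.
  chu-vandermonde : ∀ N a c → sum (weight N a c) ≈ (a + c) ⟨ N ⟩
  chu-vandermonde zero    a c = solve 0 ((con 1 :+ con 0) :* (con 1 :* con 1) :+ con 0 := con 1) refl
  chu-vandermonde (suc N) a c = begin
    sum (weight (suc N) a c)
      ≈⟨ ∑-pascal N (λ n → a ⟨ n ⟩ * c ⟨ suc N ∸ n ⟩) ⟩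
    ∑[ n ≤ N ] (ι (N C toℕ n) * (a ⟨ toℕ n ⟩ * c ⟨ suc N ∸ toℕ n ⟩ + a ⟨ suc (toℕ n) ⟩ * c ⟨ N ∸ toℕ n ⟩))
      ≈⟨ sum-cong-≋ {suc N} (λ n → step (toℕ n) (toℕ≤pred[n] n)) ⟩
    ∑[ n ≤ N ] ((a + c + ι N) * weight N a c n)
      ≈⟨ *-distribˡ-sum (a + c + ι N) (weight N a c) ⟨
    (a + c + ι N) * sum (weight N a c)
      ≈⟨ *-congˡ (chu-vandermonde N a c) ⟩
    (a + c + ι N) * (a + c) ⟨ N ⟩
      ≈⟨ *-comm _ _ ⟩
    (a + c) ⟨ suc N ⟩ ∎
    where
    step : ∀ n → n ℕ.≤ N →
           ι (N C n) * (a ⟨ n ⟩ * c ⟨ suc N ∸ n ⟩ + a ⟨ suc n ⟩ * c ⟨ N ∸ n ⟩)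
           ≈ (a + c + ι N) * (ι (N C n) * (a ⟨ n ⟩ * c ⟨ N ∸ n ⟩))
    step n n≤N = begin
      ι (N C n) * (a ⟨ n ⟩ * c ⟨ suc N ∸ n ⟩ + a ⟨ suc n ⟩ * c ⟨ N ∸ n ⟩)
        ≡⟨ ≡.cong (λ k → ι (N C n) * (a ⟨ n ⟩ * c ⟨ k ⟩ + a ⟨ suc n ⟩ * c ⟨ N ∸ n ⟩)) (ℕ.+-∸-assoc 1 n≤N) ⟩
      ι (N C n) * (a ⟨ n ⟩ * c ⟨ suc (N ∸ n) ⟩ + a ⟨ suc n ⟩ * c ⟨ N ∸ n ⟩)
        ≈⟨ solve 7 (λ B A C a c n k → B :* (A :* (C :* (c :+ k)) :+ A :* (a :+ n) :* C)
                                      := (a :+ c :+ (n :+ k)) :* (B :* (A :* C)))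
             refl (ι (N C n)) (a ⟨ n ⟩) (c ⟨ N ∸ n ⟩) a c (ι n) (ι (N ∸ n)) ⟩
      (a + c + (ι n + ι (N ∸ n))) * (ι (N C n) * (a ⟨ n ⟩ * c ⟨ N ∸ n ⟩))
        ≈⟨ *-congʳ (+-congˡ (ι-∸ n≤N)) ⟨
      (a + c + ι N) * (ι (N C n) * (a ⟨ n ⟩ * c ⟨ N ∸ n ⟩)) ∎

  -- Absorption, n C(N,n) = N C(N-1,n-1), trades one factor of n ↓ m for a
  -- shift of a, which reduces this to the case m = 0.
  factorial-moment : ∀ N m a c → m ℕ.≤ N →
    ∑[ n ≤ N ] (weight N a c n * toℕ n ↓ m) ≈ N ↓ m * a ⟨ m ⟩ * (a + c + ι m) ⟨ N ∸ m ⟩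
  factorial-moment N zero a c _ = begin
    ∑[ n ≤ N ] (weight N a c n * 1#) ≈⟨ sum-cong-≋ {suc N} (λ n → *-identityʳ (weight N a c n)) ⟩
    sum (weight N a c)               ≈⟨ chu-vandermonde N a c ⟩
    (a + c) ⟨ N ⟩                    ≈⟨ ⟨⟩-cong N (+-identityʳ (a + c)) ⟨
    (a + c + 0#) ⟨ N ⟩               ≈⟨ trans (*-congʳ (*-identityˡ 1#)) (*-identityˡ _) ⟨
    1# * 1# * (a + c + 0#) ⟨ N ⟩     ∎
  factorial-moment (suc N) (suc m) a c (s≤s m≤N) = begin
    ι 1 * (1# * c ⟨ suc N ⟩) * 0 ↓ suc m
      + ∑[ n ≤ N ] (ι (suc N C suc (toℕ n)) * (a ⟨ suc (toℕ n) ⟩ * c ⟨ N ∸ toℕ n ⟩) * suc (toℕ n) ↓ suc m)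
      -- The term at `n = 0` vanishes, so shifting the index leaves a sum up to `N`.
      ≈⟨ +-cong (trans (*-congˡ (0↓suc≈0 m)) (zeroʳ _)) (sum-cong-≋ {suc N} (λ n → step (toℕ n))) ⟩
    0# + ∑[ n ≤ N ] (ι (suc N) * a * (weight N (a + 1#) c n * toℕ n ↓ m))
      ≈⟨ trans (+-identityˡ _) (sym (*-distribˡ-sum (ι (suc N) * a) (λ n → weight N (a + 1#) c n * toℕ n ↓ m))) ⟩
    ι (suc N) * a * ∑[ n ≤ N ] (weight N (a + 1#) c n * toℕ n ↓ m)
      ≈⟨ *-congˡ (factorial-moment N m (a + 1#) c m≤N) ⟩
    ι (suc N) * a * (N ↓ m * (a + 1#) ⟨ m ⟩ * (a + 1# + c + ι m) ⟨ N ∸ m ⟩)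
      ≈⟨ solve 5 (λ n a x y z → n :* a :* (x :* y :* z) := (n :* x) :* (a :* y) :* z) refl _ _ _ _ _ ⟩
    (ι (suc N) * N ↓ m) * (a * (a + 1#) ⟨ m ⟩) * (a + 1# + c + ι m) ⟨ N ∸ m ⟩
      ≈⟨ *-cong (*-cong (sym (↓-suc N m)) (sym (⟨⟩-suc a m)))
           (⟨⟩-cong (N ∸ m) (solve 3 (λ a c m → a :+ con 1 :+ c :+ m := a :+ c :+ (con 1 :+ m)) refl a c (ι m))) ⟩
    suc N ↓ suc m * a ⟨ suc m ⟩ * (a + c + ι (suc m)) ⟨ N ∸ m ⟩ ∎
    where
    step : ∀ n → ι (suc N C suc n) * (a ⟨ suc n ⟩ * c ⟨ N ∸ n ⟩) * suc n ↓ suc m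
                 ≈ ι (suc N) * a * (ι (N C n) * ((a + 1#) ⟨ n ⟩ * c ⟨ N ∸ n ⟩) * n ↓ m)
    step n = begin
      ι (suc N C suc n) * (a ⟨ suc n ⟩ * c ⟨ N ∸ n ⟩) * suc n ↓ suc m
        ≈⟨ *-cong (*-congˡ (*-congʳ (⟨⟩-suc a n))) (↓-suc n m) ⟩
      ι (suc N C suc n) * (a * (a + 1#) ⟨ n ⟩ * c ⟨ N ∸ n ⟩) * (ι (suc n) * n ↓ m)
        ≈⟨ solve 6 (λ B a A C n f → B :* (a :* A :* C) :* (n :* f) := (n :* B) :* a :* (A :* C) :* f) refl _ _ _ _ _ _ ⟩
      (ι (suc n) * ι (suc N C suc n)) * a * ((a + 1#) ⟨ n ⟩ * c ⟨ N ∸ n ⟩) * n ↓ m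
        ≈⟨ *-congʳ (*-congʳ (*-congʳ (absorb N n))) ⟩
      (ι (suc N) * ι (N C n)) * a * ((a + 1#) ⟨ n ⟩ * c ⟨ N ∸ n ⟩) * n ↓ m
        ≈⟨ solve 5 (λ M B a X f → M :* B :* a :* X :* f := M :* a :* (B :* X :* f)) refl _ _ _ _ _ ⟩
      ι (suc N) * a * (ι (N C n) * ((a + 1#) ⟨ n ⟩ * c ⟨ N ∸ n ⟩) * n ↓ m) ∎

  -- The coefficients of the right-hand side.

  -- Three quotients simplify: `(a)_N / (a + n)_{N-n}` is `(a)_n`, `(c)_N / (c + N - n)_n` is
  -- `(c)_{N-n}`, and `(1 + n)_{N-n} (1 + N - n)_n / N!` is the binomial coefficient.
  prefactor*coefficient : ∀ N n {a b c} → n ℕ.≤ N →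
    (pre#0 : b ⟨ N ⟩ * ι (N !) # 0#)
    (den₁#0 : (a + ι n) ⟨ N ∸ n ⟩ # 0#)
    (den₂#0 : (c + ι N - ι n) ⟨ n ⟩ # 0#) →
    (a ⟨ N ⟩ * c ⟨ N ⟩) / (b ⟨ N ⟩ * ι (N !)) [ pre#0 ]
      * ( (1# + ι n) ⟨ N ∸ n ⟩ / (a + ι n) ⟨ N ∸ n ⟩ [ den₁#0 ]
        * ((1# + ι N - ι n) ⟨ n ⟩ / (c + ι N - ι n) ⟨ n ⟩ [ den₂#0 ]))
      * b ⟨ N ⟩
    ≈ ι (N C n) * (a ⟨ n ⟩ * c ⟨ N ∸ n ⟩)
  prefactor*coefficient N n {a} {b} {c} n≤N pre#0 den₁#0 den₂#0 =
    -- The factor `b ⟨ N ⟩` is already present, so clearing denominators takes only `N!`, `d₁` and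
    -- `d₂`.
    *-cancelʳ-# (x#0y#0→xy#0 (*#0⇒#0 pre#0) (x#0y#0→xy#0 den₁#0 den₂#0)) (begin
      P * (X * Y) * b ⟨ N ⟩ * (ι (N !) * (d₁ * d₂))
        ≈⟨ solve 7 (λ P X Y B f d e → P :* (X :* Y) :* B :* (f :* (d :* e)) := P :* (B :* f) :* ((X :* d) :* (Y :* e)))
             refl P X Y (b ⟨ N ⟩) (ι (N !)) d₁ d₂ ⟩
      P * (b ⟨ N ⟩ * ι (N !)) * ((X * d₁) * (Y * d₂))
        ≈⟨ *-cong (/-cancel pre#0) (*-cong (/-cancel den₁#0) (/-cancel den₂#0)) ⟩
      a ⟨ N ⟩ * c ⟨ N ⟩ * ((1# + ι n) ⟨ N ∸ n ⟩ * (1# + ι N - ι n) ⟨ n ⟩)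
        ≈⟨ *-cong (*-cong (⟨⟩-∸ a n≤N) c-split) numerators ⟩
      a ⟨ n ⟩ * d₁ * (c ⟨ N ∸ n ⟩ * d₂) * (ι (N C n) * ι (N !))
        ≈⟨ solve 6 (λ A d C e B f → A :* d :* (C :* e) :* (B :* f) := B :* (A :* C) :* (f :* (d :* e)))
             refl (a ⟨ n ⟩) d₁ (c ⟨ N ∸ n ⟩) d₂ (ι (N C n)) (ι (N !)) ⟩
      ι (N C n) * (a ⟨ n ⟩ * c ⟨ N ∸ n ⟩) * (ι (N !) * (d₁ * d₂)) ∎)
    where
    d₁ d₂ P X Y : Carrier
    d₁ = (a + ι n) ⟨ N ∸ n ⟩
    d₂ = (c + ι N - ι n) ⟨ n ⟩
    P = (a ⟨ N ⟩ * c ⟨ N ⟩) / (b ⟨ N ⟩ * ι (N !)) [ pre#0 ]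
    X = (1# + ι n) ⟨ N ∸ n ⟩ / d₁ [ den₁#0 ]
    Y = (1# + ι N - ι n) ⟨ n ⟩ / d₂ [ den₂#0 ]

    c+ι[N∸n] : c + ι (N ∸ n) ≈ c + ι N - ι n
    c+ι[N∸n] = begin
      c + ι (N ∸ n)                  ≈⟨ //-rightDividesʳ (ι n) _ ⟨
      c + ι (N ∸ n) + ι n - ι n      ≈⟨ +-congʳ (trans (+-assoc _ _ _) (+-congˡ (trans (+-comm _ _) (sym (ι-∸ n≤N))))) ⟩
      c + ι N - ι n                  ∎

    -- The cut is at `N ∸ n`, unlike the one for `a`, so that the tail has length `n` and starts at
    -- `c + N - n`.
    c-split : c ⟨ N ⟩ ≈ c ⟨ N ∸ n ⟩ * d₂
    c-split = begin
      c ⟨ N ⟩                                            ≈⟨ ⟨⟩-∸ c (ℕ.m∸n≤m N n) ⟩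
      c ⟨ N ∸ n ⟩ * (c + ι (N ∸ n)) ⟨ N ∸ (N ∸ n) ⟩      ≡⟨ ≡.cong (λ k → c ⟨ N ∸ n ⟩ * (c + ι (N ∸ n)) ⟨ k ⟩) (ℕ.m∸[m∸n]≡n n≤N) ⟩
      c ⟨ N ∸ n ⟩ * (c + ι (N ∸ n)) ⟨ n ⟩                ≈⟨ *-congˡ (⟨⟩-cong n c+ι[N∸n]) ⟩
      c ⟨ N ∸ n ⟩ * d₂                                   ∎

    numerators : (1# + ι n) ⟨ N ∸ n ⟩ * (1# + ι N - ι n) ⟨ n ⟩ ≈ ι (N C n) * ι (N !)
    numerators = begin
      (1# + ι n) ⟨ N ∸ n ⟩ * (1# + ι N - ι n) ⟨ n ⟩      ≈⟨ *-congˡ (⟨⟩-cong n (+-congʳ (+-comm 1# (ι N)))) ⟩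
      (1# + ι n) ⟨ N ∸ n ⟩ * N ↓ n                       ≈⟨ *-congˡ (↓≈C*! N n) ⟩
      (1# + ι n) ⟨ N ∸ n ⟩ * (ι (N C n) * ι (n !))       ≈⟨ solve 3 (λ x y z → x :* (y :* z) := y :* (x :* z)) refl _ _ _ ⟩
      ι (N C n) * ((1# + ι n) ⟨ N ∸ n ⟩ * ι (n !))       ≈⟨ *-congˡ (⟨⟩-! n (N ∸ n)) ⟩
      ι (N C n) * ι ((n ℕ.+ (N ∸ n)) !)                  ≡⟨ ≡.cong (λ k → ι (N C n) * ι (k !)) (ℕ.m+[n∸m]≡n n≤N) ⟩
      ι (N C n) * ι (N !)                                ∎

  -- The truncated series on both sides.

  module _ (N : ℕ) {p q : ℕ} (a b : Carrier) (as : Vector Carrier p) (bs : Vector Carrier q) (z : Carrier)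
           (lhs-adm : Admissible N (b ∷ bs) z) where

    open Admissible lhs-adm

    private
      -- Taking these denominators from the left-hand series also covers `N = 0`, where `rhs-adm`
      -- has no instance.
      lower′#0 : ∀ (m : Fin (suc N)) → ∏ (λ j → bs j ⟨ toℕ m ⟩) * ι (toℕ m !) # 0#
      lower′#0 m = *#0⇒#0 (#-congʳ (*-assoc (b ⟨ toℕ m ⟩) _ _) (lower#0 m))

    -- (N z⁻¹ - m)_m is the same for the series up to n at (n / N) z as for the
    -- one up to N at z, so both have the coefficients T m, apart from (a)_m / (b)_m.
    T : Fin (suc N) → Carrier
    T m = ∏ (λ i → as i ⟨ toℕ m ⟩) / (∏ (λ j → bs j ⟨ toℕ m ⟩) * ι (toℕ m !)) [ lower′#0 m ]
        * (1# / (ι N / z [ z#0 ] - ι (toℕ m)) ⟨ toℕ m ⟩ [ arg#0 m ])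

    truncF*⟨N⟩ : truncF N (a ∷ as) (b ∷ bs) z lhs-adm * b ⟨ N ⟩
                 ≈ ∑[ m ≤ N ] (T m * (N ↓ toℕ m * a ⟨ toℕ m ⟩ * (b + ι (toℕ m)) ⟨ N ∸ toℕ m ⟩))
    truncF*⟨N⟩ = trans (*-distribʳ-sum (b ⟨ N ⟩) summand) (sum-cong-≋ {suc N} term)
      where
      summand : Vector Carrier (suc N)
      summand m =
        ∏ (λ i → (a ∷ as) i ⟨ toℕ m ⟩) / (∏ (λ j → (b ∷ bs) j ⟨ toℕ m ⟩) * ι (toℕ m !)) [ lower#0 m ]
        * (N ↓ toℕ m / (ι N / z [ z#0 ] - ι (toℕ m)) ⟨ toℕ m ⟩ [ arg#0 m ])

      term : ∀ m → summand m * b ⟨ N ⟩ ≈ T m * (N ↓ toℕ m * a ⟨ toℕ m ⟩ * (b + ι (toℕ m)) ⟨ N ∸ toℕ m ⟩)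
      term m = begin
        X * (N ↓ k * g) * b ⟨ N ⟩
          ≈⟨ *-congˡ (⟨⟩-∸ b (toℕ≤pred[n] m)) ⟩
        X * (N ↓ k * g) * (b ⟨ k ⟩ * (b + ι k) ⟨ N ∸ k ⟩)
          ≈⟨ solve 5 (λ X f g B C → X :* (f :* g) :* (B :* C) := X :* B :* (f :* g :* C)) refl X _ _ _ _ ⟩
        X * b ⟨ k ⟩ * (N ↓ k * g * (b + ι k) ⟨ N ∸ k ⟩)
          -- The denominators of `X` and `Y` differ by the factor `(b)_k`. Multiplied by the
          -- denominator of `Y`, both sides become `(a)_k A`.
          ≈⟨ *-congʳ (*-cancelʳ-# (lower′#0 m) X*b≈a*Y) ⟩
        a ⟨ k ⟩ * Y * (N ↓ k * g * (b + ι k) ⟨ N ∸ k ⟩)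
          ≈⟨ solve 5 (λ A Y f g C → A :* Y :* (f :* g :* C) := Y :* (con 1 :* g) :* (f :* A :* C)) refl _ Y _ _ _ ⟩
        Y * (1# * g) * (N ↓ k * a ⟨ k ⟩ * (b + ι k) ⟨ N ∸ k ⟩) ∎
        where
        k : ℕ
        k = toℕ m
        A B X Y g : Carrier
        A = ∏ (λ i → as i ⟨ k ⟩)
        B = ∏ (λ j → bs j ⟨ k ⟩)
        X = (a ⟨ k ⟩ * A) / (b ⟨ k ⟩ * B * ι (k !)) [ lower#0 m ]
        Y = A / (B * ι (k !)) [ lower′#0 m ]
        g = proj₁ (#⇒invertible (arg#0 m))
        X*b≈a*Y : X * b ⟨ k ⟩ * (B * ι (k !)) ≈ a ⟨ k ⟩ * Y * (B * ι (k !))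
        X*b≈a*Y = begin
          X * b ⟨ k ⟩ * (B * ι (k !))   ≈⟨ solve 4 (λ X b B f → X :* b :* (B :* f) := X :* (b :* B :* f)) refl X _ _ _ ⟩
          X * (b ⟨ k ⟩ * B * ι (k !))   ≈⟨ /-cancel (lower#0 m) ⟩
          a ⟨ k ⟩ * A                   ≈⟨ *-congˡ (/-cancel (lower′#0 m)) ⟨
          a ⟨ k ⟩ * (Y * (B * ι (k !))) ≈⟨ *-assoc _ _ _ ⟨
          a ⟨ k ⟩ * Y * (B * ι (k !))   ∎

    module _ (rhs-adm : ∀ (j : Fin N) → Admissible (suc (toℕ j)) bs (scaled N z j)) where

      scaled-argument : ∀ j → ι (suc (toℕ j)) / scaled N z j [ Admissible.z#0 (rhs-adm j) ] ≈ ι N / z [ z#0 ]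
      scaled-argument j = sym (/-unique (Admissible.z#0 (rhs-adm j)) (begin
        ι N / z [ z#0 ] * (ι n / ι N [ N#0 ] * z)   ≈⟨ solve 3 (λ x y z → x :* (y :* z) := y :* (x :* z)) refl _ _ _ ⟩
        ι n / ι N [ N#0 ] * (ι N / z [ z#0 ] * z)   ≈⟨ *-congˡ (/-cancel z#0) ⟩
        ι n / ι N [ N#0 ] * ι N                     ≈⟨ /-cancel N#0 ⟩
        ι n                                         ∎))
        where
        n : ℕ
        n = suc (toℕ j)
        N#0 : ι N # 0#
        N#0 = ι#0 N {{nonZeroIndex j}}

      -- Since `n ↓ m` vanishes for `m > n`, the series up to `n` extends to all `m ≤ N`. The double
      -- sum then runs over a square, where the order of summation can be exchanged.
      truncFScaled≈∑T : ∀ n → truncFScaled N as bs z rhs-adm n ≈ ∑[ m ≤ N ] (T m * toℕ n ↓ toℕ m)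
      truncFScaled≈∑T n = trans (expand n) (sum-pad (s≤s (toℕ≤pred[n] n)) (summand n) _ (agree n)
        (λ m n<m → trans (*-congˡ (n<m⇒n↓m≈0 n<m)) (zeroʳ _)))
        where
        summand : ∀ n → Vector Carrier (suc (toℕ n))
        -- The conventional value at `n = 0` is treated as a sum with a single term.
        summand Fin.zero    m = 1#
        summand (Fin.suc j) m =
          ∏ (λ i → as i ⟨ toℕ m ⟩) / (∏ (λ j → bs j ⟨ toℕ m ⟩) * ι (toℕ m !)) [ lower#0′ m ]
          * (suc (toℕ j) ↓ toℕ m / (ι (suc (toℕ j)) / scaled N z j [ z#0′ ] - ι (toℕ m)) ⟨ toℕ m ⟩ [ arg#0′ m ])
          where open Admissible (rhs-adm j) renaming (z#0 to z#0′; lower#0 to lower#0′; arg#0 to arg#0′)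

        expand : ∀ n → truncFScaled N as bs z rhs-adm n ≈ sum (summand n)
        expand Fin.zero    = sym (+-identityʳ 1#)
        expand (Fin.suc j) = refl

        agree : ∀ n i m → toℕ i ≡ toℕ m → summand n i ≈ T m * toℕ n ↓ toℕ m
        -- Both quotients in `T` at `0` consist of empty products and `0!`, hence equal `1#`, as
        -- does `0 ↓ 0`.
        agree Fin.zero    Fin.zero Fin.zero _ = sym (trans (*-identityʳ _) (trans
          (*-cong (sym (/-unique _ (trans (*-identityˡ _) 1≈)))
                  (sym (/-unique _ (*-identityˡ 1#))))
          (*-identityˡ 1#)))
          where
          1≈ : ∏ (λ j → bs j ⟨ 0 ⟩) * ι (0 !) ≈ ∏ (λ i → as i ⟨ 0 ⟩)
          1≈ = trans (*-cong (∏-replicate-one q) (+-identityʳ 1#)) (trans (*-identityˡ 1#) (sym (∏-replicate-one p)))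
        agree (Fin.suc j) i m i≡m = trans
          (*-cong
            (/-cong (reflexive (≡.cong (λ k → ∏ (λ i → as i ⟨ k ⟩)) i≡m))
                    (reflexive (≡.cong (λ k → ∏ (λ j → bs j ⟨ k ⟩) * ι (k !)) i≡m)))
            (/-cong (reflexive (≡.cong (suc (toℕ j) ↓_) i≡m))
                    (trans (⟨⟩-cong (toℕ i) (+-congʳ (scaled-argument j)))
                           (reflexive (≡.cong (λ k → (ι N / z [ z#0 ] - ι k) ⟨ k ⟩) i≡m)))))
          (solve 3 (λ Y f g → Y :* (f :* g) := Y :* (con 1 :* g) :* f) refl _ _ _)

      truncF-reduction : (pre#0 : b ⟨ N ⟩ * ι (N !) # 0#)
        (den₁#0 : ∀ (n : Fin (suc N)) → (a + ι (toℕ n)) ⟨ N ∸ toℕ n ⟩ # 0#)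
        (den₂#0 : ∀ (n : Fin (suc N)) → (b - a + ι N - ι (toℕ n)) ⟨ toℕ n ⟩ # 0#) →
        truncF N (a ∷ as) (b ∷ bs) z lhs-adm
          ≈ (a ⟨ N ⟩ * (b - a) ⟨ N ⟩) / (b ⟨ N ⟩ * ι (N !)) [ pre#0 ]
            * (∑[ n ≤ N ]
                ( (1# + ι (toℕ n)) ⟨ N ∸ toℕ n ⟩ / (a + ι (toℕ n)) ⟨ N ∸ toℕ n ⟩ [ den₁#0 n ]
                * ((1# + ι N - ι (toℕ n)) ⟨ toℕ n ⟩ / (b - a + ι N - ι (toℕ n)) ⟨ toℕ n ⟩ [ den₂#0 n ])
                * truncFScaled N as bs z rhs-adm n ))
      -- `(b)_N` can be cancelled, being a factor of the denominator in `pre#0`. The chain runs from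
      -- the right-hand side to the left-hand side.
      truncF-reduction pre#0 den₁#0 den₂#0 = *-cancelʳ-# (*#0⇒#0 (#-congʳ (*-comm _ _) pre#0)) (sym (begin
        P * ∑[ n ≤ N ] (coefficient n * F n) * b ⟨ N ⟩
          ≈⟨ trans (*-congʳ (*-distribˡ-sum P (λ n → coefficient n * F n)))
                   (*-distribʳ-sum (b ⟨ N ⟩) (λ n → P * (coefficient n * F n))) ⟩
        ∑[ n ≤ N ] (P * (coefficient n * F n) * b ⟨ N ⟩)
          ≈⟨ sum-cong-≋ {suc N} expand ⟩
        ∑[ n ≤ N ] ∑[ m ≤ N ] (T m * (w n * toℕ n ↓ toℕ m))
          ≈⟨ ∑-comm (λ n m → T m * (w n * toℕ n ↓ toℕ m)) ⟩
        ∑[ m ≤ N ] ∑[ n ≤ N ] (T m * (w n * toℕ n ↓ toℕ m))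
          ≈⟨ sum-cong-≋ {suc N} collect ⟩
        ∑[ m ≤ N ] (T m * (N ↓ toℕ m * a ⟨ toℕ m ⟩ * (b + ι (toℕ m)) ⟨ N ∸ toℕ m ⟩))
          ≈⟨ truncF*⟨N⟩ ⟨
        truncF N (a ∷ as) (b ∷ bs) z lhs-adm * b ⟨ N ⟩ ∎))
        where
        P : Carrier
        P = (a ⟨ N ⟩ * (b - a) ⟨ N ⟩) / (b ⟨ N ⟩ * ι (N !)) [ pre#0 ]
        w coefficient F : Vector Carrier (suc N)
        w = weight N a (b - a)
        coefficient n = (1# + ι (toℕ n)) ⟨ N ∸ toℕ n ⟩ / (a + ι (toℕ n)) ⟨ N ∸ toℕ n ⟩ [ den₁#0 n ]
          * ((1# + ι N - ι (toℕ n)) ⟨ toℕ n ⟩ / (b - a + ι N - ι (toℕ n)) ⟨ toℕ n ⟩ [ den₂#0 n ])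
        F = truncFScaled N as bs z rhs-adm

        expand : ∀ n → P * (coefficient n * F n) * b ⟨ N ⟩ ≈ ∑[ m ≤ N ] (T m * (w n * toℕ n ↓ toℕ m))
        expand n = begin
          P * (coefficient n * F n) * b ⟨ N ⟩
            ≈⟨ solve 4 (λ P C F B → P :* (C :* F) :* B := P :* C :* B :* F) refl P (coefficient n) (F n) (b ⟨ N ⟩) ⟩
          P * coefficient n * b ⟨ N ⟩ * F n
            ≈⟨ *-cong (prefactor*coefficient N (toℕ n) (toℕ≤pred[n] n) pre#0 (den₁#0 n) (den₂#0 n)) (truncFScaled≈∑T n) ⟩
          w n * ∑[ m ≤ N ] (T m * toℕ n ↓ toℕ m)
            ≈⟨ *-distribˡ-sum (w n) (λ m → T m * toℕ n ↓ toℕ m) ⟩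
          ∑[ m ≤ N ] (w n * (T m * toℕ n ↓ toℕ m))
            ≈⟨ sum-cong-≋ {suc N} (λ m → solve 3 (λ x y z → x :* (y :* z) := y :* (x :* z)) refl (w n) (T m) (toℕ n ↓ toℕ m)) ⟩
          ∑[ m ≤ N ] (T m * (w n * toℕ n ↓ toℕ m)) ∎

        a+[b-a]≈b : a + (b - a) ≈ b
        a+[b-a]≈b = trans (+-comm _ _) (//-rightDividesˡ a b)

        collect : ∀ m → ∑[ n ≤ N ] (T m * (w n * toℕ n ↓ toℕ m))
                        ≈ T m * (N ↓ toℕ m * a ⟨ toℕ m ⟩ * (b + ι (toℕ m)) ⟨ N ∸ toℕ m ⟩)
        collect m = begin
          ∑[ n ≤ N ] (T m * (w n * toℕ n ↓ toℕ m))
            ≈⟨ *-distribˡ-sum (T m) (λ n → w n * toℕ n ↓ toℕ m) ⟨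
          T m * ∑[ n ≤ N ] (w n * toℕ n ↓ toℕ m)
            ≈⟨ *-congˡ (factorial-moment N (toℕ m) a (b - a) (toℕ≤pred[n] m)) ⟩
          T m * (N ↓ toℕ m * a ⟨ toℕ m ⟩ * (a + (b - a) + ι (toℕ m)) ⟨ N ∸ toℕ m ⟩)
            ≈⟨ *-congˡ (*-congˡ (⟨⟩-cong (N ∸ toℕ m) (+-congʳ a+[b-a]≈b))) ⟩
          T m * (N ↓ toℕ m * a ⟨ toℕ m ⟩ * (b + ι (toℕ m)) ⟨ N ∸ toℕ m ⟩) ∎

-- Specialisation to the complex numbers.

open import Defs

theorem3p3 :
    ∀ (N p q : ℕ) (a b : ℂ) (as : Vector ℂ p) (bs : Vector ℂ q) (z : ℂ)
    (lhs-adm : Admissible N (b ∷ bs) z)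
    (rhs-adm : ∀ (j : Fin N) → Admissible (suc (toℕ j)) bs (scaled N z j))
    (pre#0 : b ⟨ N ⟩ * ι (N !) # 0#)
    (den₁#0 : ∀ (n : Fin (suc N)) → (a + ι (toℕ n)) ⟨ N ∸ toℕ n ⟩ # 0#)
    (den₂#0 : ∀ (n : Fin (suc N)) → (b - a + ι N - ι (toℕ n)) ⟨ toℕ n ⟩ # 0#) →
    truncF N (a ∷ as) (b ∷ bs) z lhs-adm
      ≈ (a ⟨ N ⟩ * (b - a) ⟨ N ⟩) / (b ⟨ N ⟩ * ι (N !)) [ pre#0 ]
        * (∑[ n ≤ N ]
            ( (1# + ι (toℕ n)) ⟨ N ∸ toℕ n ⟩ / (a + ι (toℕ n)) ⟨ N ∸ toℕ n ⟩ [ den₁#0 n ]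
            * ((1# + ι N - ι (toℕ n)) ⟨ toℕ n ⟩ / (b - a + ι N - ι (toℕ n)) ⟨ toℕ n ⟩ [ den₂#0 n ])
            * truncFScaled N as bs z rhs-adm n ))
theorem3p3 N p q a b as bs z lhs-adm rhs-adm =
  truncF-reduction ℂ-heytingField ℂ-characteristicZero N a b as bs z lhs-adm rhs-adm
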